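{- For every integer $t\ge 1$ there exists an integer $n_0=n_0(t)\ge t$ such that the following holds for all integers $n\ge n_0$ and $k\ge 2$. Let $\mathscr{F}\subseteq\mathcal{K}_n(n,\ldots,n)$ be a $t$-intersecting family, where $\mathcal{K}_n(n,\ldots,n)$ has $k$ parts. Then \[ |\mathscr{F}|\le\frac{\big((n-t)_{n-t}\big)^{k}}{(n-t)!}. \] Furthermore, equality is attained if and only if $\mathscr{F}$ is a $t$-star of $\mathcal{K}_n(n,\ldots,n)$.
   Context: For a positive integer $n$, $[n]=\{1,\ldots,n\}$. For non-negative integers $b\le a$, $(a)_b=\frac{a!}{(a-b)!}$; in particular $(n-t)_{n-t}=(n-t)!$. $\mathcal{K}(n,\ldots,n)$ (with $k$ parts) denotes the complete $k$-partite $k$-graph all of whose $k$ parts are (disjoint) copies of $[n]$; its edges are identified with the $k$-tuples $(x_1,\ldots,x_k)\in[n]^k$. An $r$-matching is a set of $r$ pairwise vertex-disjoint edges, i.e. a set of $r$ such $k$-tuples any two of which differ in every coordinate. $\mathcal{K}_r(n,\ldots,n)$ is the set of all $r$-matchings of $\mathcal{K}(n,\ldots,n)$; so $\mathcal{K}_n(n,\ldots,n)$ is the set of perfect matchings. A family $\mathscr{F}\subseteq\mathcal{K}_n(n,\ldots,n)$ is $t$-intersecting if any two members of $\mathscr{F}$ share at least $t$ edges. A $t$-star of $\mathcal{K}_n(n,\ldots,n)$ is a family of the form $\{M\in\mathcal{K}_n(n,\ldots,n): C\subseteq M\}$ for some $t$-matching $C\in\mathcal{K}_t(n,\ldots,n)$.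 -}

module Defs where

open import Data.Fin.Base using (Fin; finToFun)
open import Data.Fin.Subset using (Subset; _∈_; _∩_; _⊆_; ∣_∣)
open import Data.List.Base using (List; length)
import Data.List.Membership.Propositional as List
open import Data.List.Relation.Unary.All using (All)
open import Data.List.Relation.Unary.Unique.Propositional using (Unique)
open import Data.Nat.Base using (ℕ; _^_; _∸_; _≤_; _!)
open import Data.Nat.Combinatorics using (_P_)
open import Data.Nat.DivMod using (_/_)
open import Data.Nat.Properties using (_!≢0)
open import Data.Product.Base using (_×_; ∃-syntax)
open import Function.Bundles using (_⇔_)
open import Relation.Binary.PropositionalEquality.Core using (_≡_; _≢_)

-- The edges of 𝒦(n,…,n) with k parts are the k-tuples in [n]ᵏ, enumerated
-- by Fin (n ^ k) through the library bijection finToFun / funToFin.  With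
-- this enumeration, a set of edges is a Subset, and equality of edge sets
-- is propositional equality.
Edge : ℕ → ℕ → Set
Edge k n = Fin (n ^ k)

coord : ∀ {k n} → Edge k n → Fin k → Fin n
coord {k} {n} = finToFun {n} {k}

EdgeSet : ℕ → ℕ → Set
EdgeSet k n = Subset (n ^ k)

VertexDisjoint : ∀ k n → Edge k n → Edge k n → Set
VertexDisjoint k n e f = ∀ (i : Fin k) → coord {k} {n} e i ≢ coord {k} {n} f i

-- M ∈ 𝒦ᵣ(n,…,n)
IsMatching : ∀ k n (r : ℕ) → EdgeSet k n → Set
IsMatching k n r M =
  ∣ M ∣ ≡ r ×
  (∀ (e f : Edge k n) → e ∈ M → f ∈ M → e ≢ f → VertexDisjoint k n e f)

-- A finite set ℱ ⊆ 𝒦ₙ(n,…,n), listed without repetition, so that its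
-- cardinality is the length of the list.
record Family (k n : ℕ) : Set where
  field
    members  : List (EdgeSet k n)
    unique   : Unique members
    matching : All (IsMatching k n n) members

open Family public

infix 4 _∈ᶠ_

_∈ᶠ_ : ∀ {k n} → EdgeSet k n → Family k n → Set
M ∈ᶠ ℱ = M List.∈ members ℱ

card : ∀ {k n} → Family k n → ℕ
card ℱ = length (members ℱ)

Intersecting : ∀ {k n} → ℕ → Family k n → Set
Intersecting {k} {n} t ℱ =
  ∀ (M M′ : EdgeSet k n) → M ∈ᶠ ℱ → M′ ∈ᶠ ℱ → t ≤ ∣ M ∩ M′ ∣

IsStar : ∀ {k n} → ℕ → Family k n → Set
IsStar {k} {n} t ℱ =
  ∃[ C ] IsMatching k n t C ×
         (∀ (M : EdgeSet k n) → M ∈ᶠ ℱ ⇔ (IsMatching k n n M × C ⊆ M))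

-- ((n-t)_{n-t})ᵏ / (n-t)!, where (a)_b is the library's a P b.  For k ≥ 1
-- the numerator is a multiple of (n-t)!, so the division of naturals is
-- exact.
bound : (n k t : ℕ) → ℕ
bound n k t = _/_ (((n ∸ t) P (n ∸ t)) ^ k) ((n ∸ t) !) {{(n ∸ t) !≢0}}

{-# OPTIONS --safe #-}
-- Spread approximation. Write m_s = ((n-s)!)^(k-1) for the number of perfect matchings through a given
-- s-matching, and let r be of order (log n)^3. For a family G choose S maximising
-- |G(S)| r^|S|, where G(S) = {M ∈ G : S ⊆ M}; then the sets M ∖ S with M ∈ G(S) are r-spread, and
-- |G| ≤ r^|S| m_|S|. If n is large, r^s m_s < m_u whenever u < s and u ∈ {t, t+2}. Two spread families
-- contain disjoint members, so a pair of such cores S, S′ yields members meeting inside S ∩ S′.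
--
-- Let ℱ be t-intersecting with |ℱ| ≥ m_t. Its core C has size at most t by counting, and at least t by the
-- disjointness applied to ℱ with itself. Let ℱ′ consist of the members not containing C, and suppose it
-- is nonempty. Its core cannot have size at most t+2, as it would contain C; so |ℱ′| < m_{t+2}. But
-- every member of ℱ(C) meets a fixed M ∈ ℱ′ outside C, and at least m_{t+2} of the m_t perfect matchings
-- through C do not, so |ℱ| < m_t, a contradiction. Hence ℱ lies in the t-star of C.
module Submission where

open import Defs
open import Algebra.Properties.CommutativeSemigroup as CommutativeSemigroup using ()
open import Data.Bool.Base using (true; false; if_then_else_)
import Data.Bool.Properties as Bool
open import Data.Fin.Base using (Fin; zero; suc; _↑ˡ_; _↑ʳ_; splitAt; combine; finToFun)
import Data.Fin.Properties as Fin
open import Data.Fin.Subset using (Subset; inside; outside; _∈_; _∉_; _⊆_; _∪_; _∩_; _─_; ∣_∣; ⊥; Nonempty; ⁅_⁆)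
open import Data.Fin.Subset.Properties
  using (_∈?_; _⊆?_; nonempty?; ⊆-antisym; out⊆; s⊆s; drop-∷-⊆; drop-there; ∉⊥; ∣⊥∣≡0; x∈⁅x⁆;
         x∈⁅y⁆⇒x≡y; ∣⁅x⁆∣≡1; p⊆q⇒∣p∣≤∣q∣; p⊂q⇒∣p∣<∣q∣; p⊆p∪q; q⊆p∪q;
         x∈p∪q⁺; x∈p∪q⁻; x∈p∩q⁺; x∈p∩q⁻; p─q⊆p; ∣p─q∣≤∣p∣; x∈p∧x∉q⇒x∈p─q)
open import Data.List.Base as List using (List; []; _∷_; _++_; map; length; filter; allFin; cartesianProductWith)
open import Data.List.Membership.Propositional using (find; lose) renaming (_∈_ to _∈ˡ_)
open import Data.List.Membership.Propositional.Properties using (∈-allFin; ∈-map⁻; ∈-filter⁻; ∈-filter⁺; ∈-cartesianProductWith⁺)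
open import Data.List.Properties using (length-map; length-tabulate; map-tabulate; map-++; map-∘)
open import Data.List.Relation.Unary.All as All using (All; []; _∷_)
open import Data.List.Relation.Unary.AllPairs.Core using ([]; _∷_)
open import Data.List.Relation.Unary.Any using (Any; any?; here; there)
open import Data.List.Relation.Unary.Unique.Propositional using (Unique)
import Data.List.Relation.Unary.Unique.Propositional.Properties as Unique
open import Data.Nat.Base
open import Data.Nat.Combinatorics using (nPn≡n!)
open import Data.Nat.DivMod using (_/_; _%_; m≡m%n+[m/n]*n; m%n<n; m/n*n≤m; m*n/n≡m)
open import Data.Nat.ListAction using (sum)
open import Data.Nat.ListAction.Properties using (sum-++)
open import Data.Nat.Properties
open import Data.List.Extrema ≤-totalOrder using (argmax; f[xs]≤f[argmax])
open import Data.Nat.Solver using (module +-*-Solver)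
open import Data.Product.Base using (_×_; _,_; proj₁; proj₂; ∃-syntax)
open import Data.Sum.Base using (_⊎_; inj₁; inj₂; [_,_]′)
open import Data.Vec.Base as Vec using (Vec; []; _∷_; lookup; zipWith; replicate; here; there)
open import Data.Vec.Properties using (∷-injective; ≡-dec; lookup-map; lookup-zipWith; lookup⇒[]=; []=⇒lookup)
open import Function.Base using (_∘_; _$_; case_of_)
open import Function.Bundles using (_⇔_; mk⇔; Equivalence)
open import Level using (Level)
open import Relation.Binary.Definitions using (DecidableEquality)
open import Relation.Binary.PropositionalEquality
open import Relation.Nullary using (Dec; yes; no; does; ¬_; contradiction; _×-dec_; _→-dec_; ¬?)
open import Relation.Nullary.Decidable using (dec-true; dec-false)
open import Relation.Unary using (Decidable; Pred)
open CommutativeSemigroup +-commutativeSemigroup using () renaming (interchange to +-interchange)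

-- The delicate case is two parts. The union bound over the edges of a fixed `M` allows
-- `(n - t) * m_{t+1}` matchings through `C` that meet `M` outside `C`, and with two parts this is
-- exactly `m_t`, so nothing is gained. The saving `m_{t+2}` comes from matchings through two such
-- edges, which are counted twice. This is why the core of the remaining members must be pushed
-- above size `t + 2` and not merely above `t`.
--
-- Disjoint members of two spread families come from a random colouring with `q = 2m` colours, where
-- `n < 2 ^ m`. Each family owns `m` colours and uses them class by class to shrink a member to the
-- part not yet covered, the permitted size halving from `2 ^ m` down to 1. Failures of a round are
-- counted by an encoding that costs a factor `(2q)^2` per point; a further factor `5m` keeps the
-- failures of all rounds and both families below the number of colourings. The product `80 m^3` is
-- the spreadness `r`, whence the order `(log n)^3`.

private variable
  ℓ : Level
  A B X P Q : Set ℓ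
  n q : ℕ

-- Finite sums

^-distribʳ-* : ∀ n x y → (x * y) ^ n ≡ x ^ n * y ^ n
^-distribʳ-* zero x y = refl
^-distribʳ-* (suc n) x y =
  trans (cong (x * y *_) (^-distribʳ-* n x y)) ([m*n]*[o*p]≡[m*o]*[n*p] x y (x ^ n) (y ^ n))

𝟙 : Dec P → ℕ
𝟙 d = if does d then 1 else 0

𝟙-yes : (d : Dec P) → P → 𝟙 d ≡ 1
𝟙-yes (yes _) _ = refl
𝟙-yes (no ¬p) p = contradiction p ¬p

𝟙-no : (d : Dec P) → ¬ P → 𝟙 d ≡ 0
𝟙-no (yes p) ¬p = contradiction p ¬p
𝟙-no (no _) _ = refl

𝟙≤1 : (d : Dec P) → 𝟙 d ≤ 1
𝟙≤1 (yes _) = ≤-refl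
𝟙≤1 (no _) = z≤n

𝟙-≤ : ∀ {x} (d : Dec P) → (P → 1 ≤ x) → 𝟙 d ≤ x
𝟙-≤ (yes p) h = h p
𝟙-≤ (no _) _ = z≤n

𝟙*-≤ : ∀ {x y} (d : Dec P) → (P → x ≤ y) → 𝟙 d * x ≤ y
𝟙*-≤ (yes p) h = ≤-trans (≤-reflexive (+-identityʳ _)) (h p)
𝟙*-≤ (no _) _ = z≤n

𝟙-mono : (d : Dec P) (e : Dec Q) → (P → Q) → 𝟙 d ≤ 𝟙 e
𝟙-mono d e h = 𝟙-≤ d λ p → ≤-reflexive (sym (𝟙-yes e (h p)))

𝟙-cong : (d : Dec P) (e : Dec Q) → (P → Q) → (Q → P) → 𝟙 d ≡ 𝟙 e
𝟙-cong d e f g = ≤-antisym (𝟙-mono d e f) (𝟙-mono e d g)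

𝟙-true : (d : Dec P) → 1 ≤ 𝟙 d → P
𝟙-true (yes p) _ = p

∑ : List A → (A → ℕ) → ℕ
∑ xs f = sum (map f xs)

module _ {a} {A : Set a} where

  ∑-cong : ∀ (xs : List A) {f g : A → ℕ} → (∀ x → f x ≡ g x) → ∑ xs f ≡ ∑ xs g
  ∑-cong [] h = refl
  ∑-cong (x ∷ xs) h = cong₂ _+_ (h x) (∑-cong xs h)

  ∑-mono : ∀ (xs : List A) {f g : A → ℕ} → (∀ {x} → x ∈ˡ xs → f x ≤ g x) → ∑ xs f ≤ ∑ xs g
  ∑-mono [] h = z≤n
  ∑-mono (x ∷ xs) h = +-mono-≤ (h (here refl)) (∑-mono xs (h ∘ there))

  ∑-cong-∈ : ∀ (xs : List A) {f g : A → ℕ} → (∀ {x} → x ∈ˡ xs → f x ≡ g x) → ∑ xs f ≡ ∑ xs g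
  ∑-cong-∈ xs h = ≤-antisym (∑-mono xs (≤-reflexive ∘ h)) (∑-mono xs (≤-reflexive ∘ sym ∘ h))

  ∑-const : ∀ (xs : List A) c → ∑ xs (λ _ → c) ≡ length xs * c
  ∑-const [] c = refl
  ∑-const (x ∷ xs) c = cong (c +_) (∑-const xs c)

  ∑-zero : ∀ (xs : List A) {f : A → ℕ} → (∀ x → f x ≡ 0) → ∑ xs f ≡ 0
  ∑-zero xs h = trans (∑-cong xs h) (trans (∑-const xs 0) (*-zeroʳ (length xs)))

  ∑-one : ∀ (xs : List A) → ∑ xs (λ _ → 1) ≡ length xs
  ∑-one xs = trans (∑-const xs 1) (*-identityʳ (length xs))

  ∑-+ : ∀ (xs : List A) (f g : A → ℕ) → ∑ xs (λ x → f x + g x) ≡ ∑ xs f + ∑ xs g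
  ∑-+ [] f g = refl
  ∑-+ (x ∷ xs) f g = trans (cong (f x + g x +_) (∑-+ xs f g))
    (+-interchange (f x) (g x) (∑ xs f) (∑ xs g))

  ∑-*ˡ : ∀ (xs : List A) c (f : A → ℕ) → ∑ xs (λ x → c * f x) ≡ c * ∑ xs f
  ∑-*ˡ [] c f = sym (*-zeroʳ c)
  ∑-*ˡ (x ∷ xs) c f = trans (cong (c * f x +_) (∑-*ˡ xs c f)) (sym (*-distribˡ-+ c (f x) (∑ xs f)))

  ∑-*ʳ : ∀ (xs : List A) (f : A → ℕ) c → ∑ xs (λ x → f x * c) ≡ ∑ xs f * c
  ∑-*ʳ xs f c = trans (∑-cong xs λ x → *-comm (f x) c) (trans (∑-*ˡ xs c f) (*-comm c _))

  ∑-++ : ∀ (xs ys : List A) (f : A → ℕ) → ∑ (xs ++ ys) f ≡ ∑ xs f + ∑ ys f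
  ∑-++ xs ys f = trans (cong sum (map-++ f xs ys)) (sum-++ (map f xs) (map f ys))

  ∑-term : ∀ {xs : List A} {x} (f : A → ℕ) → x ∈ˡ xs → f x ≤ ∑ xs f
  ∑-term f (here refl) = m≤m+n _ _
  ∑-term f (there x∈xs) = ≤-trans (∑-term f x∈xs) (m≤n+m _ _)

  ∑-<⇒∃ : ∀ (xs : List A) (f g : A → ℕ) → ∑ xs f < ∑ xs g → ∃[ x ] x ∈ˡ xs × f x < g x
  ∑-<⇒∃ (x ∷ xs) f g lt with f x <? g x
  ... | yes p = x , here refl , p
  ... | no ¬p = case ∑-<⇒∃ xs f g (≰⇒> λ le → <⇒≱ lt (+-mono-≤ (≮⇒≥ ¬p) le)) of
    λ { (y , y∈xs , h) → y , there y∈xs , h }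

  ∑-saturated : ∀ {xs : List A} {f g : A → ℕ} → (∀ x → f x ≤ g x) → ∑ xs g ≤ ∑ xs f →
                ∀ {x} → x ∈ˡ xs → f x ≡ g x
  ∑-saturated {x ∷ xs} {f} {g} h le (here refl) = ≤-antisym (h x)
    (+-cancelʳ-≤ (∑ xs g) _ _ (≤-trans le (+-monoʳ-≤ (f x) (∑-mono xs λ {y} _ → h y))))
  ∑-saturated {x ∷ xs} {f} {g} h le (there x∈xs) = ∑-saturated h
    (+-cancelˡ-≤ (g x) _ _ (≤-trans le (+-monoˡ-≤ (∑ xs f) (h x)))) x∈xs

  length-filter : ∀ {p} {P : Pred A p} (P? : Decidable P) xs →
                  length (filter P? xs) ≡ ∑ xs (λ x → 𝟙 (P? x))
  length-filter P? [] = refl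
  length-filter P? (x ∷ xs) with P? x
  ... | yes px = cong suc (length-filter P? xs)
  ... | no ¬px = length-filter P? xs

  ∑-filter : ∀ {p} {P : Pred A p} (P? : Decidable P) xs (f : A → ℕ) →
             ∑ (filter P? xs) f ≡ ∑ xs (λ x → 𝟙 (P? x) * f x)
  ∑-filter P? [] f = refl
  ∑-filter P? (x ∷ xs) f with P? x
  ... | yes px = cong₂ _+_ (sym (*-identityˡ (f x))) (∑-filter P? xs f)
  ... | no ¬px = ∑-filter P? xs f

∑-swap : ∀ (xs : List A) (ys : List B) (f : A → B → ℕ) →
         ∑ xs (λ x → ∑ ys (f x)) ≡ ∑ ys (λ y → ∑ xs (λ x → f x y))
∑-swap [] ys f = sym (∑-zero ys λ _ → refl)
∑-swap (x ∷ xs) ys f = trans (cong (∑ ys (f x) +_) (∑-swap xs ys f))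
                             (sym (∑-+ ys (f x) λ y → ∑ xs λ x → f x y))

∑-map : ∀ (h : A → B) xs (f : B → ℕ) → ∑ (map h xs) f ≡ ∑ xs (f ∘ h)
∑-map h xs f = cong sum (sym (map-∘ xs))

∑-cartesianProductWith : ∀ (h : A → B → X) xs ys (f : X → ℕ) →
  ∑ (cartesianProductWith h xs ys) f ≡ ∑ xs (λ x → ∑ ys (λ y → f (h x y)))
∑-cartesianProductWith h [] ys f = refl
∑-cartesianProductWith h (x ∷ xs) ys f = trans (∑-++ (map (h x) ys) _ f)
  (cong₂ _+_ (∑-map (h x) ys f) (∑-cartesianProductWith h xs ys f))

module _ {a} {A : Set a} (_≟_ : DecidableEquality A) where

  ∑-δ-≤ : ∀ {xs} → Unique xs → ∀ x (f : A → ℕ) → ∑ xs (λ y → 𝟙 (y ≟ x) * f y) ≤ f x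
  ∑-δ-≤ [] x f = z≤n
  ∑-δ-≤ {y ∷ ys} (y∉ys ∷ ys!) x f with y ≟ x
  ... | no _ = ∑-δ-≤ ys! x f
  ... | yes refl = ≤-reflexive $ begin-equality
    f y + 0 + ∑ ys (λ z → 𝟙 (z ≟ y) * f z)
      ≡⟨ cong₂ _+_ (+-identityʳ (f y)) (∑-cong-∈ ys λ {z} z∈ys →
           cong (_* f z) (𝟙-no (z ≟ y) (All.lookup y∉ys z∈ys ∘ sym))) ⟩
    f y + ∑ ys (λ _ → 0)
      ≡⟨ cong (f y +_) (∑-zero ys λ _ → refl) ⟩
    f y + 0
      ≡⟨ +-identityʳ (f y) ⟩
    f y ∎
    where open ≤-Reasoning

  ∑-δ : ∀ {xs} → Unique xs → ∀ {x} → x ∈ˡ xs → (f : A → ℕ) →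
        ∑ xs (λ y → 𝟙 (y ≟ x) * f y) ≡ f x
  ∑-δ {xs} xs! {x} x∈xs f = ≤-antisym (∑-δ-≤ xs! x f) $ begin
    f x                             ≡⟨ sym (+-identityʳ (f x)) ⟩
    1 * f x                         ≡⟨ cong (_* f x) (sym (𝟙-yes (x ≟ x) refl)) ⟩
    𝟙 (x ≟ x) * f x                 ≤⟨ ∑-term (λ y → 𝟙 (y ≟ x) * f y) x∈xs ⟩
    ∑ xs (λ y → 𝟙 (y ≟ x) * f y)    ∎
    where open ≤-Reasoning

  ∑-δ-one : ∀ {xs} → Unique xs → ∀ {x} → x ∈ˡ xs → ∑ xs (λ y → 𝟙 (y ≟ x)) ≡ 1
  ∑-δ-one {xs} xs! {x} x∈xs =
    trans (∑-cong xs λ y → sym (*-identityʳ (𝟙 (y ≟ x)))) (∑-δ xs! x∈xs λ _ → 1)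

  -- Each `x` in `xs` is charged to its occurrences in `ys`; after the sums are swapped, every `y`
  -- is charged at most once because `xs` has no repetition.
  ∑-mono-⊆ : ∀ {xs ys} → Unique xs → (∀ {x} → x ∈ˡ xs → x ∈ˡ ys) → (f : A → ℕ) → ∑ xs f ≤ ∑ ys f
  ∑-mono-⊆ {xs} {ys} xs! xs⊆ys f = begin
    ∑ xs f
      ≤⟨ ∑-mono xs (λ {x} x∈xs → begin
           f x ≡⟨ sym (+-identityʳ (f x)) ⟩
           1 * f x ≡⟨ cong (_* f x) (sym (𝟙-yes (x ≟ x) refl)) ⟩
           𝟙 (x ≟ x) * f x ≤⟨ ∑-term (λ y → 𝟙 (x ≟ y) * f y) (xs⊆ys x∈xs) ⟩
           ∑ ys (λ y → 𝟙 (x ≟ y) * f y) ∎) ⟩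
    ∑ xs (λ x → ∑ ys (λ y → 𝟙 (x ≟ y) * f y))
      ≡⟨ ∑-swap xs ys _ ⟩
    ∑ ys (λ y → ∑ xs (λ x → 𝟙 (x ≟ y) * f y))
      ≤⟨ ∑-mono ys (λ {y} _ → ∑-δ-≤ xs! y λ _ → f y) ⟩
    ∑ ys f ∎
    where open ≤-Reasoning

vectors : List A → ∀ n → List (Vec A n)
vectors xs zero = [] ∷ []
vectors xs (suc n) = cartesianProductWith _∷_ xs (vectors xs n)

∈-vectors : ∀ {xs : List A} → (∀ x → x ∈ˡ xs) → ∀ {n} (v : Vec A n) → v ∈ˡ vectors xs n
∈-vectors h [] = here refl
∈-vectors h (x ∷ v) = ∈-cartesianProductWith⁺ _∷_ (h x) (∈-vectors h v)

vectors-unique : ∀ {xs : List A} → Unique xs → ∀ n → Unique (vectors xs n)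
vectors-unique xs! zero = [] ∷ []
vectors-unique xs! (suc n) = Unique.cartesianProductWith⁺ _∷_ ∷-injective xs! (vectors-unique xs! n)

-- Subsets of a finite set

x∈p─q⇒x∉q : ∀ (p r : Subset n) {x} → x ∈ p ─ r → x ∉ r
x∈p─q⇒x∉q (_ ∷ _) (inside ∷ _) {zero} () here
x∈p─q⇒x∉q (_ ∷ p) (_ ∷ r) {suc x} (there x∈) (there x∈r) = x∈p─q⇒x∉q p r x∈ x∈r

subset-of-size : ∀ (p : Subset n) a → a ≤ ∣ p ∣ → ∃[ s ] s ⊆ p × ∣ s ∣ ≡ a
subset-of-size [] zero _ = [] , (λ ()) , refl
subset-of-size (outside ∷ p) a a≤ with subset-of-size p a a≤
... | s , s⊆p , eq = outside ∷ s , out⊆ s⊆p , eq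
subset-of-size {suc n} (inside ∷ p) zero _ = ⊥ , (λ x∈ → contradiction x∈ ∉⊥) , ∣⊥∣≡0 (suc n)
subset-of-size (inside ∷ p) (suc a) (s≤s a≤) with subset-of-size p a a≤
... | s , s⊆p , eq = inside ∷ s , s⊆s s⊆p , cong suc eq

subsets : ∀ n → List (Subset n)
subsets n = vectors (inside ∷ outside ∷ []) n

∈-subsets : ∀ (p : Subset n) → p ∈ˡ subsets n
∈-subsets = ∈-vectors λ { true → here refl ; false → there (here refl) }

subsets-unique : ∀ n → Unique (subsets n)
subsets-unique = vectors-unique (((λ ()) ∷ []) ∷ ([] ∷ []))

∑-⊆ : ∀ (p : Subset n) → ∑ (subsets n) (λ s → 𝟙 (s ⊆? p)) ≡ 2 ^ ∣ p ∣
∑-⊆ [] = refl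
∑-⊆ {suc n} (b ∷ p) = begin-equality
  ∑ (subsets (suc n)) (λ s → 𝟙 (s ⊆? b ∷ p))
    ≡⟨ ∑-cartesianProductWith _∷_ (inside ∷ outside ∷ []) (subsets n) _ ⟩
  ∑ (subsets n) (λ s → 𝟙 (inside ∷ s ⊆? b ∷ p)) + (∑ (subsets n) (λ s → 𝟙 (outside ∷ s ⊆? b ∷ p)) + 0)
    ≡⟨ cong₂ _+_ (inside-sum b) (cong (_+ 0) (trans
         (∑-cong (subsets n) λ s → 𝟙-cong (outside ∷ s ⊆? b ∷ p) (s ⊆? p) drop-∷-⊆ out⊆) (∑-⊆ p))) ⟩
  (if b then 2 ^ ∣ p ∣ else 0) + (2 ^ ∣ p ∣ + 0)
    ≡⟨ finish b ⟩
  2 ^ ∣ b ∷ p ∣ ∎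
  where
  open ≤-Reasoning
  inside-sum : ∀ b → ∑ (subsets n) (λ s → 𝟙 (inside ∷ s ⊆? b ∷ p)) ≡ (if b then 2 ^ ∣ p ∣ else 0)
  inside-sum true = trans (∑-cong (subsets n) λ s →
    𝟙-cong (inside ∷ s ⊆? inside ∷ p) (s ⊆? p) drop-∷-⊆ s⊆s) (∑-⊆ p)
  inside-sum false = ∑-zero (subsets n) λ s →
    𝟙-no (inside ∷ s ⊆? outside ∷ p) λ sub → case sub here of λ ()
  finish : ∀ b → (if b then 2 ^ ∣ p ∣ else 0) + (2 ^ ∣ p ∣ + 0) ≡ 2 ^ ∣ b ∷ p ∣
  finish true = refl
  finish false = +-identityʳ _

-- Union bound: an intersection with at least `a` points contains some `T ⊆ Y` of size exactly `a`.
-- There are at most `2 ^ ∣ Y ∣` such `T`, and spreadness limits each to a share `K / r ^ a`.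
spread-tail : ∀ (H : List (Subset n)) (χ : Subset n → Subset n) r K →
  (∀ T → ∑ H (λ S → 𝟙 (T ⊆? χ S)) * r ^ ∣ T ∣ ≤ K) →
  ∀ Y a → ∑ H (λ S → 𝟙 (a ≤? ∣ Y ∩ χ S ∣)) * r ^ a ≤ 2 ^ ∣ Y ∣ * K
spread-tail {n} H χ r K spread Y a = begin
  ∑ H (λ S → 𝟙 (a ≤? ∣ Y ∩ χ S ∣)) * r ^ a
    ≤⟨ *-monoˡ-≤ (r ^ a) (∑-mono H λ {S} _ → 𝟙-≤ (a ≤? _) (witness S)) ⟩
  ∑ H (λ S → ∑ (subsets n) (λ T → term S T)) * r ^ a
    ≡⟨ cong (_* r ^ a) (∑-swap H (subsets n) term) ⟩
  ∑ (subsets n) (λ T → ∑ H (λ S → term S T)) * r ^ a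
    ≡⟨ sym (∑-*ʳ (subsets n) _ (r ^ a)) ⟩
  ∑ (subsets n) (λ T → ∑ H (λ S → term S T) * r ^ a)
    ≤⟨ ∑-mono (subsets n) (λ {T} _ → single T) ⟩
  ∑ (subsets n) (λ T → 𝟙 (T ⊆? Y) * K)
    ≡⟨ ∑-*ʳ (subsets n) _ K ⟩
  ∑ (subsets n) (λ T → 𝟙 (T ⊆? Y)) * K
    ≡⟨ cong (_* K) (∑-⊆ Y) ⟩
  2 ^ ∣ Y ∣ * K ∎
  where
  open ≤-Reasoning
  term : Subset n → Subset n → ℕ
  term S T = 𝟙 (T ⊆? Y) * (𝟙 (∣ T ∣ ≟ a) * 𝟙 (T ⊆? χ S))
  witness : ∀ S → a ≤ ∣ Y ∩ χ S ∣ → 1 ≤ ∑ (subsets n) (term S)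
  witness S a≤ with subset-of-size (Y ∩ χ S) a a≤
  ... | T , T⊆ , ∣T∣≡a = ≤-trans (≤-reflexive (sym (cong₂ _*_ (𝟙-yes (T ⊆? Y) (proj₁ ∘ x∈p∩q⁻ Y (χ S) ∘ T⊆))
      (cong₂ _*_ (𝟙-yes (∣ T ∣ ≟ a) ∣T∣≡a) (𝟙-yes (T ⊆? χ S) (proj₂ ∘ x∈p∩q⁻ Y (χ S) ∘ T⊆))))))
    (∑-term (term S) (∈-subsets T))
  sized : ∀ T → 𝟙 (∣ T ∣ ≟ a) * ∑ H (λ S → 𝟙 (T ⊆? χ S)) * r ^ a ≤ K
  sized T = ≤-trans (≤-reflexive (*-assoc (𝟙 (∣ T ∣ ≟ a)) _ _))
    (𝟙*-≤ (∣ T ∣ ≟ a) λ { refl → spread T })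
  single : ∀ T → ∑ H (λ S → term S T) * r ^ a ≤ 𝟙 (T ⊆? Y) * K
  single T = begin
    ∑ H (λ S → term S T) * r ^ a
      ≡⟨ cong (_* r ^ a) (trans (∑-*ˡ H (𝟙 (T ⊆? Y)) _) (cong (𝟙 (T ⊆? Y) *_) (∑-*ˡ H (𝟙 (∣ T ∣ ≟ a)) _))) ⟩
    𝟙 (T ⊆? Y) * (𝟙 (∣ T ∣ ≟ a) * ∑ H (λ S → 𝟙 (T ⊆? χ S))) * r ^ a
      ≡⟨ *-assoc (𝟙 (T ⊆? Y)) _ _ ⟩
    𝟙 (T ⊆? Y) * (𝟙 (∣ T ∣ ≟ a) * ∑ H (λ S → 𝟙 (T ⊆? χ S)) * r ^ a)
      ≤⟨ *-monoʳ-≤ (𝟙 (T ⊆? Y)) (sized T) ⟩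
    𝟙 (T ⊆? Y) * K ∎

-- Fragments with respect to a random colouring

-- Probabilities become counts over all `q ^ n` colourings. One colouring exposes the random sets of
-- all rounds at once, as its disjoint classes.
Colouring : ℕ → ℕ → Set
Colouring q n = Vec (Fin q) n

colourings : ∀ q n → List (Colouring q n)
colourings q n = vectors (allFin q) n

class : Fin q → Colouring q n → Subset n
class j c = Vec.map (λ x → does (x Fin.≟ j)) c

∈-class⁺ : ∀ (j : Fin q) (c : Colouring q n) {x} → lookup c x ≡ j → x ∈ class j c
∈-class⁺ j c {x} eq = lookup⇒[]= x _ (trans (lookup-map x _ c) (dec-true (lookup c x Fin.≟ j) eq))

∈-class⁻ : ∀ (j : Fin q) (c : Colouring q n) {x} → x ∈ class j c → lookup c x ≡ j
∈-class⁻ j c {x} x∈ with lookup c x Fin.≟ j | trans (sym (lookup-map x _ c)) ([]=⇒lookup x∈)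
... | yes eq | _ = eq

recolour : Subset n → Fin q → Colouring q n → Colouring q n
recolour T j c = zipWith (λ s x → if s then j else x) T c

class-recolour-≢ : ∀ (T : Subset n) (j i : Fin q) c → i ≢ j → (∀ {x} → x ∈ T → x ∉ class i c) →
                   class i (recolour T j c) ≡ class i c
class-recolour-≢ [] j i [] i≢j disj = refl
class-recolour-≢ (outside ∷ T) j i (x ∷ c) i≢j disj =
  cong (_ ∷_) (class-recolour-≢ T j i c i≢j λ x∈T x∈ → disj (there x∈T) (there x∈))
class-recolour-≢ (inside ∷ T) j i (x ∷ c) i≢j disj = cong₂ _∷_
  (trans (dec-false (j Fin.≟ i) (i≢j ∘ sym)) (sym (dec-false (x Fin.≟ i) λ eq → disj here (∈-class⁺ i (x ∷ c) {zero} eq))))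
  (class-recolour-≢ T j i c i≢j λ x∈T x∈ → disj (there x∈T) (there x∈))

class-recolour-⊇ : ∀ (T : Subset n) (j : Fin q) c → T ⊆ class j (recolour T j c)
class-recolour-⊇ T j c {x} x∈T = ∈-class⁺ j (recolour T j c)
  (trans (lookup-zipWith _ x T c) (cong (if_then j else lookup c x) ([]=⇒lookup x∈T)))

class-recolour-⊆ : ∀ (T : Subset n) (j : Fin q) c {x} → x ∈ class j (recolour T j c) → x ∉ T → x ∈ class j c
class-recolour-⊆ T j c {x} x∈ x∉T = ∈-class⁺ j c (trans (sym (trans (lookup-zipWith _ x T c)
  (cong (if_then j else lookup c x) (out (lookup T x) refl)))) (∈-class⁻ j (recolour T j c) x∈))
  where
  out : ∀ b → lookup T x ≡ b → lookup T x ≡ outside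
  out true eq = contradiction (lookup⇒[]= x T eq) x∉T
  out false eq = eq

-- A 0/1 number rather than a predicate, so that its sum over `c` factors point by point: `q` free
-- colours at a point of `T`, one forced colour elsewhere.
agreeOff : Subset n → Colouring q n → Colouring q n → ℕ
agreeOff [] [] [] = 1
agreeOff (inside ∷ T) (_ ∷ c) (_ ∷ d) = agreeOff T c d
agreeOff (outside ∷ T) (x ∷ c) (y ∷ d) = 𝟙 (x Fin.≟ y) * agreeOff T c d

agreeOff-recolour : ∀ (T : Subset n) (j : Fin q) c → agreeOff T c (recolour T j c) ≡ 1
agreeOff-recolour [] j [] = refl
agreeOff-recolour (inside ∷ T) j (x ∷ c) = agreeOff-recolour T j c
agreeOff-recolour (outside ∷ T) j (x ∷ c) =
  cong₂ _*_ (𝟙-yes (x Fin.≟ x) refl) (agreeOff-recolour T j c)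

∑-agreeOff : ∀ (T : Subset n) (d : Colouring q n) → ∑ (colourings q n) (λ c → agreeOff T c d) ≡ q ^ ∣ T ∣
∑-agreeOff [] [] = refl
∑-agreeOff {suc n} {q} (inside ∷ T) (y ∷ d) = begin-equality
  ∑ (colourings q (suc n)) (λ c → agreeOff (inside ∷ T) c (y ∷ d))
    ≡⟨ ∑-cartesianProductWith _∷_ (allFin q) (colourings q n) _ ⟩
  ∑ (allFin q) (λ _ → ∑ (colourings q n) (λ c → agreeOff T c d))
    ≡⟨ ∑-const (allFin q) _ ⟩
  length (allFin q) * ∑ (colourings q n) (λ c → agreeOff T c d)
    ≡⟨ cong₂ _*_ (length-tabulate {n = q} λ i → i) (∑-agreeOff T d) ⟩
  q * q ^ ∣ T ∣ ∎
  where open ≤-Reasoning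
∑-agreeOff {suc n} {q} (outside ∷ T) (y ∷ d) = begin-equality
  ∑ (colourings q (suc n)) (λ c → agreeOff (outside ∷ T) c (y ∷ d))
    ≡⟨ ∑-cartesianProductWith _∷_ (allFin q) (colourings q n) _ ⟩
  ∑ (allFin q) (λ x → ∑ (colourings q n) (λ c → 𝟙 (x Fin.≟ y) * agreeOff T c d))
    ≡⟨ ∑-cong (allFin q) (λ x → trans (∑-*ˡ (colourings q n) (𝟙 (x Fin.≟ y)) _) (cong (𝟙 (x Fin.≟ y) *_) (∑-agreeOff T d))) ⟩
  ∑ (allFin q) (λ x → 𝟙 (x Fin.≟ y) * q ^ ∣ T ∣)
    ≡⟨ ∑-δ Fin._≟_ (Unique.allFin⁺ q) (∈-allFin y) (λ _ → q ^ ∣ T ∣) ⟩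
  q ^ ∣ T ∣ ∎
  where open ≤-Reasoning

module Step {n : ℕ} (H : List (Subset n)) where

  Candidate : (Subset n → Subset n) → ℕ → Subset n → Subset n → Subset n → Set
  Candidate χ a W S S′ = χ S′ ⊆ χ S ∪ W × ∣ χ S′ ─ W ∣ < a

  candidate? : ∀ χ a W S → Dec (Any (Candidate χ a W S) H)
  candidate? χ a W S = any? (λ S′ → (χ S′ ⊆? χ S ∪ W) ×-dec (∣ χ S′ ─ W ∣ <? a)) H

  -- Without a candidate `S` itself is kept: its fragment then only loses `W` and may stay large,
  -- but it is still contained in `χ S`.
  pick : (Subset n → Subset n) → ℕ → Subset n → Subset n → Subset n
  pick χ a W S with candidate? χ a W S
  ... | yes p = proj₁ (find p)
  ... | no _ = S

  step : (Subset n → Subset n) → ℕ → Subset n → Subset n → Subset n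
  step χ a W S = χ (pick χ a W S) ─ W

  module _ (χ : Subset n → Subset n) (a : ℕ) (W : Subset n) where

    pick-∈ : ∀ {S} → S ∈ˡ H → pick χ a W S ∈ˡ H
    pick-∈ {S} S∈H with candidate? χ a W S
    ... | yes p = proj₁ (proj₂ (find p))
    ... | no _ = S∈H

    pick-⊆ : ∀ S → χ (pick χ a W S) ⊆ χ S ∪ W
    pick-⊆ S with candidate? χ a W S
    ... | yes p = proj₁ (proj₂ (proj₂ (find p)))
    ... | no _ = x∈p∪q⁺ ∘ inj₁

    step-⊆ : ∀ S → step χ a W S ⊆ χ S
    step-⊆ S x∈ with x∈p∪q⁻ (χ S) W (pick-⊆ S (p─q⊆p (χ (pick χ a W S)) W x∈))
    ... | inj₁ x∈χS = x∈χS
    ... | inj₂ x∈W = contradiction x∈W (x∈p─q⇒x∉q (χ (pick χ a W S)) W x∈)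

    step-disjoint : ∀ S {x} → x ∈ step χ a W S → x ∉ W
    step-disjoint S = x∈p─q⇒x∉q (χ (pick χ a W S)) W

    -- Used in contrapositive form: if the step leaves at least `a` points, then so does every
    -- member of `H` whose fragment is covered by `χ S ∪ W`.
    step-small : ∀ {S S′} → S′ ∈ˡ H → χ S′ ⊆ χ S ∪ W → ∣ χ S′ ─ W ∣ < a → ∣ step χ a W S ∣ < a
    step-small {S} S′∈H sub lt with candidate? χ a W S
    ... | yes p = proj₂ (proj₂ (proj₂ (find p)))
    ... | no ¬p = contradiction (lose S′∈H ((λ {x} → sub {x}) , lt)) ¬p

-- One round of the fragment argument. A pair (c , S) whose fragment stays large is encoded by the
-- colouring c′ in which the whole fragment of S is moved to class j: there the fragment of S meets a
-- set determined by c′ in at least a points, which spreadness makes rare, and c is recovered from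
-- c′ by at most q ^ b choices of the old colours.
module Round {n q : ℕ} (H : List (Subset n)) (χ : Colouring q n → Subset n → Subset n)
  (j : Fin q) (a b r K : ℕ)
  (local : ∀ c S S′ → χ (recolour (χ c S) j c) S′ ≡ χ c S′)
  (spread : ∀ c T → ∑ H (λ S → 𝟙 (T ⊆? χ c S)) * r ^ ∣ T ∣ ≤ K) where

  open Step H
  open ≤-Reasoning

  bad? : ∀ c S → Dec (∣ χ c S ∣ < b × a ≤ ∣ step (χ c) a (class j c) S ∣)
  bad? c S = (∣ χ c S ∣ <? b) ×-dec (a ≤? ∣ step (χ c) a (class j c) S ∣)

  inClass? : ∀ c → Dec (Any (λ S → ∣ χ c S ∣ < b × χ c S ⊆ class j c) H)
  inClass? c = any? (λ S → (∣ χ c S ∣ <? b) ×-dec (χ c S ⊆? class j c)) H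

  -- The encoding needs a small fragment inside class `j` that can be read off the colouring alone.
  -- If the fragment of some `S` was moved to class `j`, that fragment shows that one exists.
  -- Whichever is found has at most `b` points, hence at most `2 ^ b` subsets; the default `⊥`
  -- respects this bound.
  anchor : Colouring q n → Subset n
  anchor c with inClass? c
  ... | yes p = χ c (proj₁ (find p))
  ... | no _ = ⊥

  ∣anchor∣≤b : ∀ c → ∣ anchor c ∣ ≤ b
  ∣anchor∣≤b c with inClass? c
  ... | yes p = <⇒≤ (proj₁ (proj₂ (proj₂ (find p))))
  ... | no _ = ≤-trans (≤-reflexive (∣⊥∣≡0 n)) z≤n

  anchor-spec : ∀ c {S} → S ∈ˡ H → ∣ χ c S ∣ < b → χ c S ⊆ class j c →
                ∃[ S₀ ] S₀ ∈ˡ H × χ c S₀ ⊆ class j c × anchor c ≡ χ c S₀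
  anchor-spec c S∈H lt sub with inClass? c
  ... | yes p = let S₀ , S₀∈H , _ , S₀⊆ = find p in S₀ , S₀∈H , S₀⊆ , refl
  ... | no ¬p = contradiction (lose S∈H (lt , λ {x} → sub {x})) ¬p

  -- A decoding condition stated through `c′`. For fixed `c′` and `S` at most `q ^ b` colourings `c`
  -- satisfy it, since only the colours on the fragment were forgotten; `spread-tail` at `anchor c′`
  -- then makes the sum over `S` small.
  code : Colouring q n → Subset n → Colouring q n → ℕ
  code c′ S c = 𝟙 (∣ χ c′ S ∣ <? b) * (𝟙 (a ≤? ∣ anchor c′ ∩ χ c′ S ∣) * agreeOff (χ c′ S) c c′)

  bad⇒code : ∀ c {S} → S ∈ˡ H → ∣ χ c S ∣ < b × a ≤ ∣ step (χ c) a (class j c) S ∣ →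
             code (recolour (χ c S) j c) S c ≡ 1
  bad⇒code c {S} S∈H (small , large) = cong₂ _*_ (𝟙-yes (_ <? b) small′)
    (cong₂ _*_ (𝟙-yes (a ≤? _) meets) (trans (cong (λ T → agreeOff T c c′) (local c S S)) (agreeOff-recolour (χ c S) j c)))
    where
    c′ = recolour (χ c S) j c
    small′ : ∣ χ c′ S ∣ < b
    small′ = subst (λ T → ∣ T ∣ < b) (sym (local c S S)) small
    meets : a ≤ ∣ anchor c′ ∩ χ c′ S ∣
    meets with anchor-spec c′ S∈H small′ (subst (_⊆ class j c′) (sym (local c S S)) (class-recolour-⊇ (χ c S) j c))
    -- If fewer than `a` points of `χ c S₀` lay outside the class, `S₀` would be a candidate and the
    -- step from `S` would be small. So at least `a` points lie outside, and by `cover` all of them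
    -- belong to `χ c S`.
    ... | S₀ , S₀∈H , S₀⊆ , eq = ≤-trans (≮⇒≥ λ lt → <⇒≱ (step-small (χ c) a (class j c) S₀∈H cover lt) large)
            (p⊆q⇒∣p∣≤∣q∣ inter)
      where
      cover : χ c S₀ ⊆ χ c S ∪ class j c
      cover {x} x∈ with x ∈? χ c S
      ... | yes x∈S = x∈p∪q⁺ (inj₁ x∈S)
      ... | no x∉S = x∈p∪q⁺ (inj₂ (class-recolour-⊆ (χ c S) j c (S₀⊆ (subst (x ∈_) (sym (local c S S₀)) x∈)) x∉S))
      inter : χ c S₀ ─ class j c ⊆ anchor c′ ∩ χ c′ S
      inter {x} x∈ with x∈p∪q⁻ (χ c S) (class j c) (cover (p─q⊆p (χ c S₀) (class j c) x∈))
      ... | inj₂ x∈W = contradiction x∈W (x∈p─q⇒x∉q (χ c S₀) (class j c) x∈)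
      ... | inj₁ x∈S = x∈p∩q⁺ (subst (x ∈_) (sym (trans eq (local c S S₀))) (p─q⊆p (χ c S₀) (class j c) x∈)
                              , subst (x ∈_) (sym (local c S S)) x∈S)

  ∑-code : ∀ c′ S → ∑ (colourings q n) (code c′ S) ≤ 𝟙 (a ≤? ∣ anchor c′ ∩ χ c′ S ∣) * q ^ b
  ∑-code c′ S = begin
    ∑ (colourings q n) (code c′ S)
      ≡⟨ trans (∑-*ˡ (colourings q n) (𝟙 (∣ χ c′ S ∣ <? b)) _) (cong (𝟙 (∣ χ c′ S ∣ <? b) *_) (trans (∑-*ˡ
                (colourings q n) (𝟙 (a ≤? ∣ anchor c′ ∩ χ c′ S ∣)) _)
           (cong (𝟙 (a ≤? ∣ anchor c′ ∩ χ c′ S ∣) *_) (∑-agreeOff (χ c′ S) c′)))) ⟩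
    𝟙 (∣ χ c′ S ∣ <? b) * (𝟙 (a ≤? ∣ anchor c′ ∩ χ c′ S ∣) * q ^ ∣ χ c′ S ∣)
      ≤⟨ bounded ⟩
    𝟙 (a ≤? ∣ anchor c′ ∩ χ c′ S ∣) * q ^ b ∎
    where
    q≢0 : NonZero q
    q≢0 = Fin.nonZeroIndex j
    bounded : 𝟙 (∣ χ c′ S ∣ <? b) * (𝟙 (a ≤? ∣ anchor c′ ∩ χ c′ S ∣) * q ^ ∣ χ c′ S ∣) ≤
            𝟙 (a ≤? ∣ anchor c′ ∩ χ c′ S ∣) * q ^ b
    bounded = 𝟙*-≤ (∣ χ c′ S ∣ <? b) λ lt →
      *-monoʳ-≤ (𝟙 (a ≤? ∣ anchor c′ ∩ χ c′ S ∣)) (^-monoʳ-≤ q {{q≢0}} (<⇒≤ lt))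

  ∑-bad : ∑ (colourings q n) (λ c → ∑ H (λ S → 𝟙 (bad? c S))) * r ^ a ≤
          length (colourings q n) * (q ^ b * (2 ^ b * K))
  ∑-bad = begin
    ∑ cs (λ c → ∑ H (λ S → 𝟙 (bad? c S))) * r ^ a
      ≤⟨ *-monoˡ-≤ (r ^ a) (∑-mono cs λ {c} _ → ∑-mono H λ {S} S∈H → 𝟙-≤ (bad? c S) λ bad →
           ≤-trans (≤-reflexive (sym (bad⇒code c S∈H bad)))
             (∑-term (λ c′ → code c′ S c) (∈-vectors ∈-allFin (recolour (χ c S) j c)))) ⟩
    ∑ cs (λ c → ∑ H (λ S → ∑ cs (λ c′ → code c′ S c))) * r ^ a
      -- Reorder the sums so that the image `c′` is outermost and the preimage `c` innermost.
      ≡⟨ cong (_* r ^ a) (trans (∑-cong cs λ c → ∑-swap H cs (λ S c′ → code c′ S c)) (trans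
           (∑-swap cs cs (λ c c′ → ∑ H (λ S → code c′ S c))) (∑-cong cs λ c′ → ∑-swap cs H (λ c S → code c′ S c)))) ⟩
    ∑ cs (λ c′ → ∑ H (λ S → ∑ cs (code c′ S))) * r ^ a
      ≤⟨ *-monoˡ-≤ (r ^ a) (∑-mono cs λ {c′} _ → ∑-mono H λ {S} _ → ∑-code c′ S) ⟩
    ∑ cs (λ c′ → ∑ H (λ S → 𝟙 (a ≤? ∣ anchor c′ ∩ χ c′ S ∣) * q ^ b)) * r ^ a
      ≡⟨ sym (∑-*ʳ cs _ (r ^ a)) ⟩
    ∑ cs (λ c′ → ∑ H (λ S → 𝟙 (a ≤? ∣ anchor c′ ∩ χ c′ S ∣) * q ^ b) * r ^ a)
      ≤⟨ ∑-mono cs (λ {c′} _ → rare c′) ⟩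
    ∑ cs (λ _ → q ^ b * (2 ^ b * K))
      ≡⟨ ∑-const cs _ ⟩
    length cs * (q ^ b * (2 ^ b * K)) ∎
    where
    cs = colourings q n
    rare : ∀ c′ → ∑ H (λ S → 𝟙 (a ≤? ∣ anchor c′ ∩ χ c′ S ∣) * q ^ b) * r ^ a ≤ q ^ b * (2 ^ b * K)
    rare c′ = begin
      ∑ H (λ S → 𝟙 (a ≤? ∣ anchor c′ ∩ χ c′ S ∣) * q ^ b) * r ^ a
        ≡⟨ cong (_* r ^ a) (trans (∑-*ʳ H _ (q ^ b)) (*-comm _ (q ^ b))) ⟩
      q ^ b * ∑ H (λ S → 𝟙 (a ≤? ∣ anchor c′ ∩ χ c′ S ∣)) * r ^ a
        ≡⟨ *-assoc (q ^ b) _ _ ⟩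
      q ^ b * (∑ H (λ S → 𝟙 (a ≤? ∣ anchor c′ ∩ χ c′ S ∣)) * r ^ a)
        ≤⟨ *-monoʳ-≤ (q ^ b) (spread-tail H (χ c′) r K (spread c′) (anchor c′) a) ⟩
      q ^ b * (2 ^ ∣ anchor c′ ∣ * K)
        ≤⟨ *-monoʳ-≤ (q ^ b) (*-monoˡ-≤ K (^-monoʳ-≤ 2 (∣anchor∣≤b c′))) ⟩
      q ^ b * (2 ^ b * K) ∎

∣p∣≥1 : ∀ {n} {p : Subset n} {x} → x ∈ p → 1 ≤ ∣ p ∣
∣p∣≥1 here = s≤s z≤n
∣p∣≥1 (there {y = true} x∈p) = s≤s z≤n
∣p∣≥1 (there {y = false} x∈p) = ∣p∣≥1 x∈p

-- The two factors of `(2 * q) ^ 2 * D` have separate tasks. In a round that goes from size bound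
-- `b = 2a` to `a`, the encoding costs `q ^ b * 2 ^ b = ((2 * q) ^ 2) ^ a`, which the first factor
-- cancels exactly; the second leaves a gain of `D ^ a ≥ D`. Each round thus loses at most a
-- fraction `2 / D` of all pairs of a colouring and a member.
module Fragments {n q : ℕ} (H : List (Subset n)) (base : Subset n → Subset n) (m D : ℕ)
  (small : ∀ {S} → S ∈ˡ H → ∣ base S ∣ < 2 ^ m)
  (spread : ∀ T → ∑ H (λ S → 𝟙 (T ⊆? base S)) * ((2 * q) ^ 2 * D) ^ ∣ T ∣ ≤ 2 * length H)
  .{{_ : NonZero D}} where

  open Step H
  open ≤-Reasoning

  -- The head of the list is the latest round. After `i` rounds the threshold is `2 ^ (m ∸ i)`, so
  -- each round aims below half of the previous threshold.
  frag : List (Fin q) → Colouring q n → Subset n → Subset n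
  frag [] c = base
  frag (j ∷ js) c = step (frag js c) (2 ^ (m ∸ suc (length js))) (class j c)

  frag-⊆ : ∀ js c S → frag js c S ⊆ base S
  frag-⊆ [] c S x∈ = x∈
  frag-⊆ (j ∷ js) c S = frag-⊆ js c S ∘ step-⊆ (frag js c) _ (class j c) S

  frag-disjoint : ∀ js c S {x} → x ∈ frag js c S → ∀ {j} → j ∈ˡ js → x ∉ class j c
  frag-disjoint (j ∷ js) c S x∈ (here refl) = step-disjoint (frag js c) _ (class j c) S x∈
  frag-disjoint (j ∷ js) c S x∈ (there i∈js) =
    frag-disjoint js c S (step-⊆ (frag js c) _ (class j c) S x∈) i∈js

  -- Following the picks back to round zero, a fragment is seen to contain all that is left of a
  -- genuine `base S′` once the colours in `js` are removed. Hence an empty fragment exhibits a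
  -- member coloured by `js` alone.
  frag-cover : ∀ js c {S} → S ∈ˡ H →
    ∃[ S′ ] S′ ∈ˡ H × (∀ x → x ∈ base S′ → x ∈ frag js c S ⊎ lookup c x ∈ˡ js)
  frag-cover [] c {S} S∈H = S , S∈H , λ _ → inj₁
  frag-cover (j ∷ js) c {S} S∈H
    with frag-cover js c (pick-∈ (frag js c) (2 ^ (m ∸ suc (length js))) (class j c) S∈H)
  ... | S′ , S′∈H , covered = S′ , S′∈H , λ x x∈ → extend x (covered x x∈)
    where
    χ = frag js c
    picked = pick χ (2 ^ (m ∸ suc (length js))) (class j c) S
    extend : ∀ x → x ∈ χ picked ⊎ lookup c x ∈ˡ js → x ∈ χ picked ─ class j c ⊎ lookup c x ∈ˡ j ∷ js
    extend x (inj₂ c∈js) = inj₂ (there c∈js)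
    extend x (inj₁ x∈) with x ∈? class j c
    ... | yes x∈W = inj₂ (here (∈-class⁻ j c x∈W))
    ... | no x∉W = inj₁ (x∈p∧x∉q⇒x∈p─q x∈ x∉W)

  -- `frag js` reads the colouring only through the classes in `js`. Moving points that lie outside
  -- these classes into a further class changes none of them; this supplies `local` in `Round`.
  frag-recolour : ∀ js c T j → (∀ {i} → i ∈ˡ js → i ≢ j) →
    (∀ {x} → x ∈ T → ∀ {i} → i ∈ˡ js → x ∉ class i c) → frag js (recolour T j c) ≡ frag js c
  frag-recolour [] c T j _ _ = refl
  frag-recolour (i ∷ js) c T j i≢j disj = cong₂ (λ χ W → step χ (2 ^ (m ∸ suc (length js))) W)
    (frag-recolour js c T j (i≢j ∘ there) λ x∈T i∈ → disj x∈T (there i∈))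
    (class-recolour-≢ T j i c (i≢j (here refl)) λ x∈T → disj x∈T (here refl))

  frag-spread : ∀ js c T →
    ∑ H (λ S → 𝟙 (T ⊆? frag js c S)) * ((2 * q) ^ 2 * D) ^ ∣ T ∣ ≤ 2 * length H
  frag-spread js c T = ≤-trans (*-monoˡ-≤ (((2 * q) ^ 2 * D) ^ ∣ T ∣) (∑-mono H λ {S} _ →
    𝟙-mono (T ⊆? frag js c S) (T ⊆? base S) λ T⊆ {x} x∈ → frag-⊆ js c S (T⊆ x∈))) (spread T)

  large? : ∀ js c S → Dec (2 ^ (m ∸ length js) ≤ ∣ frag js c S ∣)
  large? js c S = 2 ^ (m ∸ length js) ≤? ∣ frag js c S ∣

  private
    cs = colourings q n

  -- A fragment that is large after a round either was large already, or was small before and makes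
  -- a bad pair in that round. At the start none is large, by `small`.
  ∑-large : ∀ js → Unique js → length js ≤ m →
    ∑ cs (λ c → ∑ H (λ S → 𝟙 (large? js c S))) * D ≤ length js * (length cs * (2 * length H))
  ∑-large [] _ _ = ≤-reflexive (cong (_* D) (trans (∑-cong-∈ cs λ {c} _ →
    trans (∑-cong-∈ H λ {S} S∈H → 𝟙-no (large? [] c S) (<⇒≱ (small S∈H))) (∑-zero H λ _ → refl))
    (∑-zero cs λ _ → refl)))
  ∑-large (j ∷ js) (j∉js ∷ js!) lt = begin
    ∑ cs (λ c → ∑ H (λ S → 𝟙 (large? (j ∷ js) c S))) * D
      ≤⟨ *-monoˡ-≤ D (∑-mono cs λ {c} _ → ∑-mono H λ {S} _ → 𝟙-≤ (large? (j ∷ js) c S) (split c S)) ⟩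
    ∑ cs (λ c → ∑ H (λ S → 𝟙 (R.bad? c S) + 𝟙 (large? js c S))) * D
      ≡⟨ cong (_* D) (trans (∑-cong cs λ c → ∑-+ H _ _) (∑-+ cs _ _)) ⟩
    (∑ cs (λ c → ∑ H (λ S → 𝟙 (R.bad? c S))) + ∑ cs (λ c → ∑ H (λ S → 𝟙 (large? js c S)))) * D
      ≡⟨ *-distribʳ-+ D (∑ cs (λ c → ∑ H (λ S → 𝟙 (R.bad? c S)))) _ ⟩
    ∑ cs (λ c → ∑ H (λ S → 𝟙 (R.bad? c S))) * D + ∑ cs (λ c → ∑ H (λ S → 𝟙 (large? js c S))) * D
      ≤⟨ +-mono-≤ few (∑-large js js! (≤-trans (n≤1+n _) lt)) ⟩
    length cs * (2 * length H) + length js * (length cs * (2 * length H)) ∎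
    where
    a = 2 ^ (m ∸ suc (length js))
    b = 2 ^ (m ∸ length js)
    b≡2a : b ≡ 2 * a
    b≡2a = cong (2 ^_) (+-∸-assoc 1 lt)
    module R = Round H (frag js) j a b ((2 * q) ^ 2 * D) (2 * length H)
      (λ c S S′ → cong (λ χ → χ S′) (frag-recolour js c (frag js c S) j
        (λ i∈js i≡j → All.lookup j∉js i∈js (sym i≡j)) (frag-disjoint js c S)))
      (frag-spread js)
    split : ∀ c S → a ≤ ∣ frag (j ∷ js) c S ∣ → 1 ≤ 𝟙 (R.bad? c S) + 𝟙 (large? js c S)
    split c S a≤ with b ≤? ∣ frag js c S ∣
    ... | yes b≤ = ≤-trans (≤-reflexive (sym (𝟙-yes (large? js c S) b≤))) (m≤n+m _ _)
    ... | no b≰ = ≤-trans (≤-reflexive (sym (𝟙-yes (R.bad? c S) (≰⇒> b≰ , a≤)))) (m≤m+n _ _)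
    E = ((2 * q) ^ 2) ^ a
    instance
      q≢0 : NonZero q
      q≢0 = Fin.nonZeroIndex j
      2q≢0 : NonZero (2 * q)
      2q≢0 = m*n≢0 2 q
      2q²≢0 : NonZero ((2 * q) ^ 2)
      2q²≢0 = m^n≢0 (2 * q) 2
      E≢0 : NonZero E
      E≢0 = m^n≢0 ((2 * q) ^ 2) a
      a≢0 : NonZero a
      a≢0 = m^n≢0 2 (m ∸ suc (length js))
    D≤D^a : D ≤ D ^ a
    D≤D^a = ≤-trans (≤-reflexive (sym (^-identityʳ D))) (^-monoʳ-≤ D (>-nonZero⁻¹ a))
    colours : q ^ b * (2 ^ b * (2 * length H)) ≡ 2 * length H * E
    colours = begin-equality
      q ^ b * (2 ^ b * (2 * length H))
        ≡⟨ sym (*-assoc (q ^ b) (2 ^ b) _) ⟩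
      q ^ b * 2 ^ b * (2 * length H)
        ≡⟨ *-comm (q ^ b * 2 ^ b) _ ⟩
      2 * length H * (q ^ b * 2 ^ b)
        ≡⟨ cong (2 * length H *_) (trans (*-comm (q ^ b) (2 ^ b)) (trans (sym (^-distribʳ-* b 2 q))
             (trans (cong ((2 * q) ^_) b≡2a) (sym (^-*-assoc (2 * q) 2 a))))) ⟩
      2 * length H * E ∎
    few : ∑ cs (λ c → ∑ H (λ S → 𝟙 (R.bad? c S))) * D ≤ length cs * (2 * length H)
    few = *-cancelʳ-≤ _ _ E (begin
      total * D * E                           ≤⟨ *-monoˡ-≤ E (*-monoʳ-≤ total D≤D^a) ⟩
      total * D ^ a * E                       ≡⟨ trans (*-assoc total _ E) (cong (total *_) (*-comm (D ^ a) E)) ⟩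
      total * (E * D ^ a)                     ≡⟨ cong (total *_) (sym (^-distribʳ-* a ((2 * q) ^ 2) D)) ⟩
      total * ((2 * q) ^ 2 * D) ^ a           ≤⟨ R.∑-bad ⟩
      length cs * (q ^ b * (2 ^ b * (2 * length H))) ≡⟨ cong (length cs *_) colours ⟩
      length cs * (2 * length H * E)      ≡⟨ sym (*-assoc (length cs) _ E) ⟩
      length cs * (2 * length H) * E      ∎)
      where total = ∑ cs (λ c → ∑ H (λ S → 𝟙 (R.bad? c S)))

  Captured : List (Fin q) → Colouring q n → Subset n → Set
  Captured js c S = ∀ x → x ∈ base S → lookup c x ∈ˡ js

  captured? : ∀ js c → Dec (Any (Captured js c) H)
  captured? js c = any? (λ S → Fin.all? λ x → (x ∈? base S) →-dec any? (lookup c x Fin.≟_) js) H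

  -- After `m` rounds the threshold is `2 ^ 0 = 1`, so large means nonempty, and an empty fragment
  -- would yield a captured member by `frag-cover`.
  uncaptured⇒large : ∀ js c → length js ≡ m → ¬ Any (Captured js c) H → ∀ {S} → S ∈ˡ H →
                     2 ^ (m ∸ length js) ≤ ∣ frag js c S ∣
  uncaptured⇒large js c len ¬cap {S} S∈H
    with frag-cover js c S∈H | nonempty? (frag js c S)
  ... | _ | yes (x , x∈) = ≤-trans (≤-reflexive (cong (2 ^_) (trans (cong (_∸ length js) (sym len)) (n∸n≡0 (length js)))))
                             (∣p∣≥1 x∈)
  ... | S′ , S′∈H , covered | no empty = contradiction
        (lose S′∈H λ x x∈ → case covered x x∈ of λ
          { (inj₁ x∈frag) → contradiction (x , x∈frag) empty ; (inj₂ c∈js) → c∈js }) ¬cap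

  -- An uncaptured colouring makes every member of `H` large, so `∑-large` counts it `length H`
  -- times; this factor cancels.
  ∑-uncaptured : ∀ js → Unique js → length js ≡ m → 1 ≤ length H →
    ∑ cs (λ c → 𝟙 (¬? (captured? js c))) * D ≤ m * (2 * length cs)
  ∑-uncaptured js js! len H≢[] = *-cancelʳ-≤ _ _ (length H) {{>-nonZero H≢[]}} (begin
    U * D * length H
      ≡⟨ trans (*-assoc U D _) (trans (cong (U *_) (*-comm D (length H))) (sym (*-assoc U (length H) D))) ⟩
    U * length H * D
      ≡⟨ cong (_* D) (sym (∑-*ʳ cs _ (length H))) ⟩
    ∑ cs (λ c → 𝟙 (¬? (captured? js c)) * length H) * D
      ≤⟨ *-monoˡ-≤ D (∑-mono cs λ {c} _ → 𝟙*-≤ (¬? (captured? js c)) λ ¬cap →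
           ≤-reflexive (trans (sym (∑-one H)) (sym (∑-cong-∈ H λ {S} S∈H →
             𝟙-yes (large? js c S) (uncaptured⇒large js c len ¬cap S∈H))))) ⟩
    ∑ cs (λ c → ∑ H (λ S → 𝟙 (large? js c S))) * D
      ≤⟨ ∑-large js js! (≤-reflexive len) ⟩
    length js * (length cs * (2 * length H))
      ≡⟨ cong₂ _*_ len (solve 2 (λ x y → x :* (con 2 :* y) := con 2 :* x :* y) refl (length cs) (length H)) ⟩
    m * (2 * length cs * length H)
      ≡⟨ sym (*-assoc m _ (length H)) ⟩
    m * (2 * length cs) * length H ∎)
    where
    U = ∑ cs (λ c → 𝟙 (¬? (captured? js c)))
    open +-*-Solver

-- This is `(2 * q) ^ 2 * D` with `q = m + m` and `D = 5 * m`. Over `m` rounds each family fails for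
-- at most `2m / 5m` of the colourings, and two shares of 2/5 leave a colouring that serves both.
rate : ℕ → ℕ
rate m = (2 * (m + m)) ^ 2 * (5 * m)

-- Colour the ground set with 2m colours: for more than half of all colourings, each family has a member
-- using only its own m colours.
spread⇒disjoint : ∀ {n} m → 1 ≤ m → (H₁ H₂ : List (Subset n)) (base₁ base₂ : Subset n → Subset n) →
  1 ≤ length H₁ → 1 ≤ length H₂ →
  (∀ {S} → S ∈ˡ H₁ → ∣ base₁ S ∣ < 2 ^ m) → (∀ {S} → S ∈ˡ H₂ → ∣ base₂ S ∣ < 2 ^ m) →
  (∀ T → ∑ H₁ (λ S → 𝟙 (T ⊆? base₁ S)) * rate m ^ ∣ T ∣ ≤ 2 * length H₁) →
  (∀ T → ∑ H₂ (λ S → 𝟙 (T ⊆? base₂ S)) * rate m ^ ∣ T ∣ ≤ 2 * length H₂) →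
  ∃[ S₁ ] ∃[ S₂ ] S₁ ∈ˡ H₁ × S₂ ∈ˡ H₂ × (∀ x → x ∈ base₁ S₁ → x ∉ base₂ S₂)
spread⇒disjoint {n} m@(suc m-1) _ H₁ H₂ base₁ base₂ H₁≢[] H₂≢[] small₁ small₂ spread₁ spread₂ =
  case ∑-<⇒∃ cs bad (λ _ → 1) few of λ { (c , _ , bad<1) → conclude c bad<1 }
  where
  open ≤-Reasoning
  cs = colourings (m + m) n
  module F₁ = Fragments {q = m + m} H₁ base₁ m (5 * m) small₁ spread₁
  module F₂ = Fragments {q = m + m} H₂ base₂ m (5 * m) small₂ spread₂
  js₁ js₂ : List (Fin (m + m))
  js₁ = List.map (_↑ˡ m) (allFin m)
  js₂ = List.map (m ↑ʳ_) (allFin m)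
  bad : Colouring (m + m) n → ℕ
  bad c = 𝟙 (¬? (F₁.captured? js₁ c)) + 𝟙 (¬? (F₂.captured? js₂ c))
  bounded : ∀ x → x * (5 * m) ≤ m * (2 * length cs) → x * 5 ≤ 2 * length cs
  bounded x le = *-cancelˡ-≤ m (≤-trans (≤-reflexive
    (trans (*-comm m (x * 5)) (*-assoc x 5 m))) le)
  length-half : ∀ (f : Fin m → Fin (m + m)) → length (List.map f (allFin m)) ≡ m
  length-half f = trans (length-map f (allFin m)) (length-tabulate {n = m} λ i → i)
  U₁ = ∑ cs (λ c → 𝟙 (¬? (F₁.captured? js₁ c)))
  U₂ = ∑ cs (λ c → 𝟙 (¬? (F₂.captured? js₂ c)))
  few : ∑ cs bad < ∑ cs (λ _ → 1)
  few = *-cancelʳ-< 5 _ _ (begin-strict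
    ∑ cs bad * 5
      ≡⟨ cong (_* 5) (∑-+ cs _ _) ⟩
    (U₁ + U₂) * 5
      ≡⟨ *-distribʳ-+ 5 U₁ U₂ ⟩
    U₁ * 5 + U₂ * 5
      ≤⟨ +-mono-≤
           (bounded U₁ (F₁.∑-uncaptured js₁ (Unique.map⁺ (λ {x} {y} → Fin.↑ˡ-injective m x y) (Unique.allFin⁺ m)) (length-half _) H₁≢[]))
           (bounded U₂ (F₂.∑-uncaptured js₂ (Unique.map⁺ (λ {x} {y} → Fin.↑ʳ-injective m x y) (Unique.allFin⁺ m)) (length-half _) H₂≢[])) ⟩
    2 * length cs + 2 * length cs
      ≡⟨ sym (*-distribʳ-+ (length cs) 2 2) ⟩
    4 * length cs
      <⟨ *-monoˡ-< (length cs) {{>-nonZero nonempty}} {4} {5} ≤-refl ⟩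
    5 * length cs
      ≡⟨ *-comm 5 (length cs) ⟩
    length cs * 5
      ≡⟨ cong (_* 5) (sym (∑-one cs)) ⟩
    ∑ cs (λ _ → 1) * 5 ∎)
    where
    nonempty : 1 ≤ length cs
    nonempty = ≤-trans (∑-term {xs = cs} {replicate n zero} (λ _ → 1) (∈-vectors ∈-allFin _)) (≤-reflexive (∑-one cs))
  ↑ˡ≢↑ʳ : ∀ (i j : Fin m) → i ↑ˡ m ≢ m ↑ʳ j
  ↑ˡ≢↑ʳ i j eq = case trans (sym (Fin.splitAt-↑ˡ m i m)) (trans (cong (splitAt m) eq) (Fin.splitAt-↑ʳ m m j)) of λ ()
  conclude : ∀ c → bad c < 1 →
    ∃[ S₁ ] ∃[ S₂ ] S₁ ∈ˡ H₁ × S₂ ∈ˡ H₂ × (∀ x → x ∈ base₁ S₁ → x ∉ base₂ S₂)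
  conclude c bad<1 with F₁.captured? js₁ c | F₂.captured? js₂ c
  ... | no _ | no _ = contradiction bad<1 λ { (s≤s ()) }
  ... | no _ | yes _ = contradiction bad<1 λ { (s≤s ()) }
  ... | yes _ | no _ = contradiction bad<1 λ { (s≤s ()) }
  ... | yes p₁ | yes p₂ =
    let S₁ , S₁∈ , cap₁ = find p₁
        S₂ , S₂∈ , cap₂ = find p₂
    in S₁ , S₂ , S₁∈ , S₂∈ , λ x x∈₁ x∈₂ →
      let i , _ , eq₁ = ∈-map⁻ (_↑ˡ m) (cap₁ x x∈₁)
          j , _ , eq₂ = ∈-map⁻ (m ↑ʳ_) (cap₂ x x∈₂)
      in ↑ˡ≢↑ʳ i j (trans (sym eq₁) eq₂)

∣p∪q∣≡∣p∣+∣q∣ : ∀ (p r : Subset n) → (∀ {x} → x ∈ p → x ∉ r) → ∣ p ∪ r ∣ ≡ ∣ p ∣ + ∣ r ∣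
∣p∪q∣≡∣p∣+∣q∣ [] [] _ = refl
∣p∪q∣≡∣p∣+∣q∣ (inside ∷ p) (inside ∷ r) disj = contradiction here (disj here)
∣p∪q∣≡∣p∣+∣q∣ (inside ∷ p) (outside ∷ r) disj = cong suc (∣p∪q∣≡∣p∣+∣q∣ p r λ x∈ y∈ → disj (there x∈) (there y∈))
∣p∪q∣≡∣p∣+∣q∣ (outside ∷ p) (inside ∷ r) disj =
  trans (cong suc (∣p∪q∣≡∣p∣+∣q∣ p r λ x∈ y∈ → disj (there x∈) (there y∈))) (sym (+-suc ∣ p ∣ ∣ r ∣))
∣p∪q∣≡∣p∣+∣q∣ (outside ∷ p) (outside ∷ r) disj = ∣p∪q∣≡∣p∣+∣q∣ p r λ x∈ y∈ → disj (there x∈) (there y∈)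

∣p∪⁅x⁆∣ : ∀ (p : Subset n) {x} → x ∉ p → ∣ p ∪ ⁅ x ⁆ ∣ ≡ suc ∣ p ∣
∣p∪⁅x⁆∣ p {x} x∉p = trans (∣p∪q∣≡∣p∣+∣q∣ p ⁅ x ⁆ λ y∈p y∈x → x∉p (subst (_∈ p) (x∈⁅y⁆⇒x≡y x y∈x) y∈p))
  (trans (cong (∣ p ∣ +_) (∣⁅x⁆∣≡1 x)) (+-comm ∣ p ∣ 1))

∑-allFin-suc : ∀ n (f : Fin (suc n) → ℕ) → ∑ (allFin (suc n)) f ≡ f zero + ∑ (allFin n) (f ∘ suc)
∑-allFin-suc n f = cong (f zero +_) (trans (cong (λ xs → ∑ xs f) (sym (map-tabulate (λ i → i) suc))) (∑-map suc (allFin n) f))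

∑-∈ : ∀ (p : Subset n) → ∑ (allFin n) (λ x → 𝟙 (x ∈? p)) ≡ ∣ p ∣
∑-∈ [] = refl
∑-∈ {suc n} (s ∷ p) = trans (∑-allFin-suc n _) (trans (cong (𝟙 (zero ∈? s ∷ p) +_)
  (trans (∑-cong (allFin n) λ x → 𝟙-cong (suc x ∈? s ∷ p) (x ∈? p) drop-there there) (∑-∈ p))) (head s))
  where
  head : ∀ s → 𝟙 (zero ∈? s ∷ p) + ∣ p ∣ ≡ ∣ s ∷ p ∣
  head true = refl
  head false = refl

∪-⊆ : ∀ (p r s : Subset n) → p ⊆ s → r ⊆ s → p ∪ r ⊆ s
∪-⊆ p r s p⊆s r⊆s x∈ = [ p⊆s , r⊆s ]′ (x∈p∪q⁻ p r x∈)

⁅x⁆⊆ : ∀ {p : Subset n} {x} → x ∈ p → ⁅ x ⁆ ⊆ p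
⁅x⁆⊆ {p = p} {x} x∈p y∈ = subst (_∈ p) (sym (x∈⁅y⁆⇒x≡y x y∈)) x∈p

-- Cores

degree : List (Subset n) → Subset n → ℕ
degree G S = ∑ G (λ M → 𝟙 (S ⊆? M))

IsCore : List (Subset n) → ℕ → Subset n → Set
IsCore G r S = ∀ T → degree G T * r ^ ∣ T ∣ ≤ degree G S * r ^ ∣ S ∣

abstract
  core : ∀ (G : List (Subset n)) r → ∃[ S ] IsCore G r S
  core {n} G r = argmax f ⊥ (subsets n) , λ T → All.lookup (f[xs]≤f[argmax] ⊥ (subsets n)) (∈-subsets T)
    where
    f : Subset n → ℕ
    f T = degree G T * r ^ ∣ T ∣

degree-⊥ : ∀ (G : List (Subset n)) → degree G ⊥ ≡ length G
degree-⊥ G = trans (∑-cong G λ M → 𝟙-yes (⊥ ⊆? M) λ x∈ → contradiction x∈ ∉⊥) (∑-one G)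

core-size : ∀ (G : List (Subset n)) r S → IsCore G r S → length G ≤ degree G S * r ^ ∣ S ∣
core-size {n} G r S isCore = begin
  length G             ≡⟨ sym (degree-⊥ G) ⟩
  degree G ⊥           ≡⟨ sym (*-identityʳ _) ⟩
  degree G ⊥ * 1       ≡⟨ cong (λ k → degree G ⊥ * r ^ k) (sym (∣⊥∣≡0 n)) ⟩
  degree G ⊥ * r ^ ∣ ⊥ {n} ∣ ≤⟨ isCore ⊥ ⟩
  degree G S * r ^ ∣ S ∣ ∎
  where open ≤-Reasoning

core-degree : ∀ (G : List (Subset n)) r S → IsCore G r S → 1 ≤ length G → 1 ≤ degree G S
core-degree G r S isCore G≢[] = pos (≤-trans G≢[] (core-size G r S isCore))
  where
  pos : ∀ {x y} → 1 ≤ x * y → 1 ≤ x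
  pos {suc x} _ = s≤s z≤n

-- Maximality compared at `S ∪ T`; disjointness splits the power and the factor `r ^ ∣ S ∣` cancels.
core-spread : ∀ (G : List (Subset n)) r .{{_ : NonZero r}} S → IsCore G r S →
              ∀ T → (∀ {x} → x ∈ S → x ∉ T) → degree G (S ∪ T) * r ^ ∣ T ∣ ≤ degree G S
core-spread G r S isCore T disj = *-cancelʳ-≤ _ _ (r ^ ∣ S ∣) {{m^n≢0 r ∣ S ∣}} (begin
  degree G (S ∪ T) * r ^ ∣ T ∣ * r ^ ∣ S ∣
    ≡⟨ *-assoc (degree G (S ∪ T)) _ _ ⟩
  degree G (S ∪ T) * (r ^ ∣ T ∣ * r ^ ∣ S ∣)
    ≡⟨ cong (degree G (S ∪ T) *_) (trans (*-comm (r ^ ∣ T ∣) _) (trans (sym (^-distribˡ-+-* r ∣ S ∣ ∣ T ∣))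
         (cong (r ^_) (sym (∣p∪q∣≡∣p∣+∣q∣ S T disj))))) ⟩
  degree G (S ∪ T) * r ^ ∣ S ∪ T ∣
    ≤⟨ isCore (S ∪ T) ⟩
  degree G S * r ^ ∣ S ∣ ∎)
  where open ≤-Reasoning

-- `A` is the core of the other family, and members whose part outside `S` meets `A` are discarded.
-- By spreadness each point of `A` outside `S` removes at most a fraction `1 / r` of the members
-- through `S`, so `2 * ∣ A ∣ ≤ r` keeps at least half of them. This is the source of the factor 2
-- in the spreadness bounds.
module Link (G : List (Subset n)) (r : ℕ) .{{_ : NonZero r}} (S A : Subset n)
  (isCore : IsCore G r S) (∣A∣-small : 2 * ∣ A ∣ ≤ r) where

  open ≤-Reasoning

  private
    inLink? : ∀ M → Dec (S ⊆ M × ¬ Nonempty ((M ─ S) ∩ A))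
    inLink? M = (S ⊆? M) ×-dec ¬? (nonempty? ((M ─ S) ∩ A))

  link : List (Subset n)
  link = filter inLink? G

  ∈-link⁻ : ∀ {M} → M ∈ˡ link → M ∈ˡ G × S ⊆ M × (∀ {x} → x ∈ M ─ S → x ∉ A)
  ∈-link⁻ {M} M∈ with ∈-filter⁻ inLink? {xs = G} M∈
  ... | M∈G , S⊆M , empty = M∈G , (λ {x} → S⊆M {x}) , λ {x} x∈ x∈A → empty (x , x∈p∩q⁺ (x∈ , x∈A))

  private
    hits = ∑ G (λ M → 𝟙 ((S ⊆? M) ×-dec nonempty? ((M ─ S) ∩ A)))

    degree≤ : degree G S ≤ length link + hits
    degree≤ = begin
      degree G S
        ≤⟨ ∑-mono G (λ {M} _ → 𝟙-≤ (S ⊆? M) (split M)) ⟩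
      ∑ G (λ M → 𝟙 (inLink? M) + 𝟙 ((S ⊆? M) ×-dec nonempty? ((M ─ S) ∩ A)))
        ≡⟨ ∑-+ G _ _ ⟩
      ∑ G (λ M → 𝟙 (inLink? M)) + hits
        ≡⟨ cong (_+ hits) (sym (length-filter inLink? G)) ⟩
      length link + hits ∎
      where
      split : ∀ M → S ⊆ M → 1 ≤ 𝟙 (inLink? M) + 𝟙 ((S ⊆? M) ×-dec nonempty? ((M ─ S) ∩ A))
      split M S⊆M with nonempty? ((M ─ S) ∩ A)
      ... | yes h = ≤-trans (≤-reflexive (sym (𝟙-yes ((S ⊆? M) ×-dec yes h) ((λ {x} → S⊆M {x}) , h)))) (m≤n+m _ _)
      ... | no ¬h = ≤-trans (≤-reflexive (sym (𝟙-yes ((S ⊆? M) ×-dec ¬? (no ¬h)) ((λ {x} → S⊆M {x}) , ¬h)))) (m≤m+n _ _)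

    hits≤ : hits * r ≤ ∣ A ∣ * degree G S
    hits≤ = begin
      hits * r
        ≤⟨ *-monoˡ-≤ r (∑-mono G λ {M} _ → 𝟙-≤ ((S ⊆? M) ×-dec nonempty? ((M ─ S) ∩ A)) λ { (S⊆M , y) → witness M S⊆M y }) ⟩
      ∑ G (λ M → ∑ (allFin n) (λ x → 𝟙 (x ∈? A) * (𝟙 (¬? (x ∈? S)) * 𝟙 (S ∪ ⁅ x ⁆ ⊆? M)))) * r
        ≡⟨ cong (_* r) (trans (∑-swap G (allFin n) _) (∑-cong (allFin n) λ x →
             trans (∑-*ˡ G (𝟙 (x ∈? A)) _) (cong (𝟙 (x ∈? A) *_) (∑-*ˡ G (𝟙 (¬? (x ∈? S))) _)))) ⟩
      ∑ (allFin n) (λ x → 𝟙 (x ∈? A) * (𝟙 (¬? (x ∈? S)) * degree G (S ∪ ⁅ x ⁆))) * r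
        ≡⟨ sym (∑-*ʳ (allFin n) _ r) ⟩
      ∑ (allFin n) (λ x → 𝟙 (x ∈? A) * (𝟙 (¬? (x ∈? S)) * degree G (S ∪ ⁅ x ⁆)) * r)
        ≤⟨ ∑-mono (allFin n) (λ {x} _ → ≤-trans
             (≤-reflexive (trans (*-assoc (𝟙 (x ∈? A)) _ r) (cong (𝟙 (x ∈? A) *_) (*-assoc (𝟙 (¬? (x ∈? S))) _ r))))
             (*-monoʳ-≤ (𝟙 (x ∈? A)) (𝟙*-≤ (¬? (x ∈? S)) (single x)))) ⟩
      ∑ (allFin n) (λ x → 𝟙 (x ∈? A) * degree G S)
        ≡⟨ trans (∑-*ʳ (allFin n) _ (degree G S)) (cong (_* degree G S) (∑-∈ A)) ⟩
      ∣ A ∣ * degree G S ∎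
      where
      witness : ∀ M → S ⊆ M → Nonempty ((M ─ S) ∩ A) →
                1 ≤ ∑ (allFin n) (λ x → 𝟙 (x ∈? A) * (𝟙 (¬? (x ∈? S)) * 𝟙 (S ∪ ⁅ x ⁆ ⊆? M)))
      witness M S⊆M (x , x∈) with x∈p∩q⁻ (M ─ S) A x∈
      ... | x∈M─S , x∈A = ≤-trans (≤-reflexive (sym (cong₂ _*_ (𝟙-yes (x ∈? A) x∈A)
          (cong₂ _*_ (𝟙-yes (¬? (x ∈? S)) (x∈p─q⇒x∉q M S x∈M─S))
            (𝟙-yes (S ∪ ⁅ x ⁆ ⊆? M) (∪-⊆ S ⁅ x ⁆ M S⊆M (⁅x⁆⊆ (p─q⊆p M S x∈M─S))))))))
        (∑-term (λ x → 𝟙 (x ∈? A) * (𝟙 (¬? (x ∈? S)) * 𝟙 (S ∪ ⁅ x ⁆ ⊆? M))) (∈-allFin x))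
      single : ∀ x → x ∉ S → degree G (S ∪ ⁅ x ⁆) * r ≤ degree G S
      single x x∉S = ≤-trans (≤-reflexive (cong (degree G (S ∪ ⁅ x ⁆) *_)
          (sym (trans (cong (r ^_) (∣⁅x⁆∣≡1 x)) (*-identityʳ r)))))
        (core-spread G r S isCore ⁅ x ⁆ λ y∈S y∈x → x∉S (subst (_∈ S) (x∈⁅y⁆⇒x≡y x y∈x) y∈S))

  degree≤2*length-link : degree G S ≤ 2 * length link
  degree≤2*length-link = +-cancelˡ-≤ (degree G S) _ _ (begin
    degree G S + degree G S            ≡⟨ cong (degree G S +_) (sym (+-identityʳ _)) ⟩
    2 * degree G S                     ≤⟨ *-monoʳ-≤ 2 degree≤ ⟩
    2 * (length link + hits)           ≡⟨ *-distribˡ-+ 2 (length link) hits ⟩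
    2 * length link + 2 * hits         ≤⟨ +-monoʳ-≤ (2 * length link) few ⟩
    2 * length link + degree G S       ≡⟨ +-comm (2 * length link) _ ⟩
    degree G S + 2 * length link       ∎)
    where
    few : 2 * hits ≤ degree G S
    few = *-cancelʳ-≤ _ _ r (begin
      2 * hits * r            ≡⟨ *-assoc 2 hits r ⟩
      2 * (hits * r)          ≤⟨ *-monoʳ-≤ 2 hits≤ ⟩
      2 * (∣ A ∣ * degree G S) ≡⟨ sym (*-assoc 2 ∣ A ∣ _) ⟩
      2 * ∣ A ∣ * degree G S   ≤⟨ *-monoˡ-≤ (degree G S) ∣A∣-small ⟩
      r * degree G S          ≡⟨ *-comm r _ ⟩
      degree G S * r          ∎)

  link-nonempty : 1 ≤ length G → 1 ≤ length link
  link-nonempty G≢[] = pos (≤-trans (core-degree G r S isCore G≢[]) degree≤2*length-link)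
    where
    pos : ∀ {x} → 1 ≤ 2 * x → 1 ≤ x
    pos {suc x} _ = s≤s z≤n

  link-spread : ∀ T → ∑ link (λ M → 𝟙 (T ⊆? M ─ S)) * r ^ ∣ T ∣ ≤ 2 * length link
  link-spread T with nonempty? (S ∩ T)
  ... | yes (x , x∈) = ≤-trans (≤-reflexive (cong (_* r ^ ∣ T ∣) (∑-zero link λ M →
          𝟙-no (T ⊆? M ─ S) λ T⊆ → let x∈S , x∈T = x∈p∩q⁻ S T x∈ in x∈p─q⇒x∉q M S (T⊆ x∈T) x∈S))) z≤n
  ... | no disj = begin
    ∑ link (λ M → 𝟙 (T ⊆? M ─ S)) * r ^ ∣ T ∣
      ≡⟨ cong (_* r ^ ∣ T ∣) (∑-filter inLink? G _) ⟩
    ∑ G (λ M → 𝟙 (inLink? M) * 𝟙 (T ⊆? M ─ S)) * r ^ ∣ T ∣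
      ≤⟨ *-monoˡ-≤ (r ^ ∣ T ∣) (∑-mono G λ {M} _ → 𝟙*-≤ (inLink? M) λ { (S⊆M , _) →
           𝟙-mono (T ⊆? M ─ S) (S ∪ T ⊆? M) λ T⊆ {x} → ∪-⊆ S T M S⊆M (p─q⊆p M S ∘ T⊆) {x} }) ⟩
    degree G (S ∪ T) * r ^ ∣ T ∣
      ≤⟨ core-spread G r S isCore T (λ x∈S x∈T → disj (_ , x∈p∩q⁺ (x∈S , x∈T))) ⟩
    degree G S
      ≤⟨ degree≤2*length-link ⟩
    2 * length link ∎

-- Spreadness makes the remainders `M₁ ─ S₁` and `M₂ ─ S₂` disjoint from each other, and the choice
-- of the links makes each disjoint from the opposite core. A common point therefore lies in both
-- cores.
cores-meet : ∀ m → 1 ≤ m → (G₁ G₂ : List (Subset n)) (S₁ S₂ : Subset n) →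
  (∀ {M} → M ∈ˡ G₁ → ∣ M ∣ < 2 ^ m) → (∀ {M} → M ∈ˡ G₂ → ∣ M ∣ < 2 ^ m) →
  IsCore G₁ (rate m) S₁ → IsCore G₂ (rate m) S₂ → 2 * ∣ S₁ ∣ ≤ rate m → 2 * ∣ S₂ ∣ ≤ rate m →
  1 ≤ length G₁ → 1 ≤ length G₂ →
  ∃[ M₁ ] ∃[ M₂ ] M₁ ∈ˡ G₁ × M₂ ∈ˡ G₂ × S₁ ⊆ M₁ × S₂ ⊆ M₂ × M₁ ∩ M₂ ⊆ S₁ ∩ S₂
cores-meet m@(suc _) 1≤m G₁ G₂ S₁ S₂ size₁ size₂ core₁ core₂ small₁ small₂ G₁≢[] G₂≢[] =
  case spread⇒disjoint m 1≤m L₁.link L₂.link (_─ S₁) (_─ S₂) (L₁.link-nonempty G₁≢[]) (L₂.link-nonempty G₂≢[])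
         (λ {M} M∈ → ≤-<-trans (∣p─q∣≤∣p∣ M S₁) (size₁ (proj₁ (L₁.∈-link⁻ M∈))))
         (λ {M} M∈ → ≤-<-trans (∣p─q∣≤∣p∣ M S₂) (size₂ (proj₁ (L₂.∈-link⁻ M∈))))
         L₁.link-spread L₂.link-spread
  of λ { (M₁ , M₂ , M₁∈ , M₂∈ , disj) → conclude M₁ M₂ (L₁.∈-link⁻ M₁∈) (L₂.∈-link⁻ M₂∈) disj }
  where
  module L₁ = Link G₁ (rate m) S₁ S₂ core₁ small₂
  module L₂ = Link G₂ (rate m) S₂ S₁ core₂ small₁
  conclude : ∀ M₁ M₂ → M₁ ∈ˡ G₁ × S₁ ⊆ M₁ × (∀ {x} → x ∈ M₁ ─ S₁ → x ∉ S₂) →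
    M₂ ∈ˡ G₂ × S₂ ⊆ M₂ × (∀ {x} → x ∈ M₂ ─ S₂ → x ∉ S₁) → (∀ x → x ∈ M₁ ─ S₁ → x ∉ M₂ ─ S₂) →
    ∃[ M₁ ] ∃[ M₂ ] M₁ ∈ˡ G₁ × M₂ ∈ˡ G₂ × S₁ ⊆ M₁ × S₂ ⊆ M₂ × M₁ ∩ M₂ ⊆ S₁ ∩ S₂
  conclude M₁ M₂ (M₁∈ , S₁⊆ , off₁) (M₂∈ , S₂⊆ , off₂) disj =
    M₁ , M₂ , M₁∈ , M₂∈ , (λ {x} → S₁⊆ {x}) , (λ {x} → S₂⊆ {x}) , meet
    where
    meet : M₁ ∩ M₂ ⊆ S₁ ∩ S₂
    meet {x} x∈ with x∈p∩q⁻ M₁ M₂ x∈ | x ∈? S₁ | x ∈? S₂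
    ... | _ | yes x∈S₁ | yes x∈S₂ = x∈p∩q⁺ (x∈S₁ , x∈S₂)
    ... | x∈M₁ , x∈M₂ | yes x∈S₁ | no x∉S₂ = contradiction x∈S₁ (off₂ (x∈p∧x∉q⇒x∈p─q x∈M₂ x∉S₂))
    ... | x∈M₁ , x∈M₂ | no x∉S₁ | yes x∈S₂ = contradiction x∈S₂ (off₁ (x∈p∧x∉q⇒x∈p─q x∈M₁ x∉S₁))
    ... | x∈M₁ , x∈M₂ | no x∉S₁ | no x∉S₂ =
      contradiction (x∈p∧x∉q⇒x∈p─q x∈M₂ x∉S₂) (disj x (x∈p∧x∉q⇒x∈p─q x∈M₁ x∉S₁))

-- Sums and products over the coordinates of an edge

𝟙-× : ∀ {p q} {P : Set p} {Q : Set q} (d : Dec P) (e : Dec Q) → 𝟙 (d ×-dec e) ≡ 𝟙 d * 𝟙 e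
𝟙-× (yes _) e = sym (+-identityʳ _)
𝟙-× (no _) e = refl

∑-subsingleton : ∀ {a p} {A : Set a} {P : Pred A p} → DecidableEquality A → (P? : Decidable P) → ∀ {xs} → Unique xs →
  (∀ {x y} → P x → P y → x ≡ y) → ∑ xs (λ x → 𝟙 (P? x)) ≤ 1
∑-subsingleton _≟ᴬ_ P? {xs} xs! prop with any? P? xs
... | yes p = ≤-trans (∑-mono xs λ {y} _ → ≤-trans (𝟙-mono (P? y) (y ≟ᴬ x) λ py → prop py px) (≤-reflexive (sym (*-identityʳ _))))
    (∑-δ-≤ _≟ᴬ_ xs! x λ _ → 1)
  where
  x = proj₁ (find p)
  px = proj₂ (proj₂ (find p))
... | no ¬p = ≤-trans (≤-reflexive (trans (∑-cong-∈ xs λ {y} y∈ → 𝟙-no (P? y) (¬p ∘ lose y∈)) (∑-zero xs λ _ → refl))) z≤n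

∑-allFin-+ : ∀ a b (f : Fin (a + b) → ℕ) →
  ∑ (allFin (a + b)) f ≡ ∑ (allFin a) (λ i → f (i ↑ˡ b)) + ∑ (allFin b) (λ j → f (a ↑ʳ j))
∑-allFin-+ zero b f = refl
∑-allFin-+ (suc a) b f = begin-equality
  ∑ (allFin (suc a + b)) f
    ≡⟨ ∑-allFin-suc (a + b) f ⟩
  f zero + ∑ (allFin (a + b)) (f ∘ suc)
    ≡⟨ cong (f zero +_) (∑-allFin-+ a b (f ∘ suc)) ⟩
  f zero + (∑ (allFin a) (λ i → f (suc (i ↑ˡ b))) + ∑ (allFin b) (λ j → f (suc (a ↑ʳ j))))
    ≡⟨ sym (+-assoc (f zero) _ _) ⟩
  f zero + ∑ (allFin a) (λ i → f (suc (i ↑ˡ b))) + ∑ (allFin b) (λ j → f (suc (a ↑ʳ j)))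
    ≡⟨ cong (_+ ∑ (allFin b) (λ j → f (suc (a ↑ʳ j)))) (sym (∑-allFin-suc a λ i → f (i ↑ˡ b))) ⟩
  ∑ (allFin (suc a)) (λ i → f (i ↑ˡ b)) + ∑ (allFin b) (λ j → f (suc a ↑ʳ j)) ∎
  where open ≤-Reasoning

∑-combine : ∀ a b (f : Fin (a * b) → ℕ) →
  ∑ (allFin (a * b)) f ≡ ∑ (allFin a) (λ i → ∑ (allFin b) (λ j → f (combine i j)))
∑-combine zero b f = refl
∑-combine (suc a) b f = trans (∑-allFin-+ b (a * b) f) (trans
  (cong (∑ (allFin b) (λ j → f (j ↑ˡ (a * b))) +_) (∑-combine a b (λ j → f (b ↑ʳ j))))
  (sym (∑-allFin-suc a _)))

∏ : ∀ k → (Fin k → ℕ) → ℕ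
∏ zero f = 1
∏ (suc k) f = f zero * ∏ k (f ∘ suc)

∏-cong : ∀ k {f g : Fin k → ℕ} → (∀ i → f i ≡ g i) → ∏ k f ≡ ∏ k g
∏-cong zero h = refl
∏-cong (suc k) h = cong₂ _*_ (h zero) (∏-cong k (h ∘ suc))

∏-const : ∀ k c → ∏ k (λ _ → c) ≡ c ^ k
∏-const zero c = refl
∏-const (suc k) c = cong (c *_) (∏-const k c)

∏-vanish : ∀ k (f : Fin k → ℕ) i → f i ≡ 0 → ∏ k f ≡ 0
∏-vanish (suc k) f zero eq = cong (_* ∏ k (f ∘ suc)) eq
∏-vanish (suc k) f (suc i) eq = trans (cong (f zero *_) (∏-vanish k (f ∘ suc) i eq)) (*-zeroʳ (f zero))

-- An edge is an independent choice of one vertex in each part, so a sum of products of vertex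
-- weights factors over the parts.
∑-∏ : ∀ n k (w : Fin k → Fin n → ℕ) →
  ∑ (allFin (n ^ k)) (λ e → ∏ k (λ j → w j (finToFun {n} {k} e j))) ≡ ∏ k (λ j → ∑ (allFin n) (w j))
∑-∏ n zero w = refl
∑-∏ n (suc k) w = begin-equality
  ∑ (allFin (n * n ^ k)) (λ e → ∏ (suc k) (λ j → w j (finToFun {n} {suc k} e j)))
    ≡⟨ ∑-combine n (n ^ k) _ ⟩
  ∑ (allFin n) (λ i → ∑ (allFin (n ^ k)) (λ e → ∏ (suc k) (λ j → w j (finToFun {n} {suc k} (combine i e) j))))
    ≡⟨ ∑-cong (allFin n) (λ i → ∑-cong (allFin (n ^ k)) (λ e → split i e)) ⟩
  ∑ (allFin n) (λ i → ∑ (allFin (n ^ k)) (λ e → w zero i * ∏ k (λ j → w (suc j) (finToFun {n} {k} e j))))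
    ≡⟨ ∑-cong (allFin n) (λ i → trans (∑-*ˡ (allFin (n ^ k)) (w zero i) _) (cong (w zero i *_) (∑-∏ n k (λ j → w (suc j))))) ⟩
  ∑ (allFin n) (λ i → w zero i * ∏ k (λ j → ∑ (allFin n) (w (suc j))))
    ≡⟨ ∑-*ʳ (allFin n) (w zero) _ ⟩
  ∏ (suc k) (λ j → ∑ (allFin n) (w j)) ∎
  where
  open ≤-Reasoning
  split : ∀ i e → ∏ (suc k) (λ j → w j (finToFun {n} {suc k} (combine i e) j)) ≡
                  w zero i * ∏ k (λ j → w (suc j) (finToFun {n} {k} e j))
  split i e = cong (λ q → w zero (proj₁ q) * ∏ k (λ j → w (suc j) (finToFun {n} {k} (proj₂ q) j)))
    (Fin.remQuot-combine {n} {n ^ k} i e)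

-- Counting perfect matchings

_≟ˢ_ : ∀ {n} → DecidableEquality (Subset n)
_≟ˢ_ = ≡-dec Bool._≟_

-- There are `suc k` parts, so that the exponent, which is one less than the number of parts, is `k`
-- itself.
module Matchings (k n : ℕ) where

  open ≤-Reasoning

  private
    coord′ : Edge (suc k) n → Fin (suc k) → Fin n
    coord′ = coord {suc k} {n}

    edges : List (Edge (suc k) n)
    edges = allFin (n ^ suc k)

  Matching : ℕ → EdgeSet (suc k) n → Set
  Matching = IsMatching (suc k) n

  matching? : ∀ r M → Dec (Matching r M)
  matching? r M = (∣ M ∣ ≟ r) ×-dec Fin.all? λ e → Fin.all? λ f →
    (e ∈? M) →-dec (f ∈? M) →-dec ¬? (e Fin.≟ f) →-dec Fin.all? λ i → ¬? (coord′ e i Fin.≟ coord′ f i)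

  ⊆-matching : ∀ {r S M} → Matching r M → S ⊆ M → Matching ∣ S ∣ S
  ⊆-matching (_ , disj) S⊆M = refl , λ e f e∈ f∈ → disj e f (S⊆M e∈) (S⊆M f∈)

  Compatible : EdgeSet (suc k) n → Edge (suc k) n → Set
  Compatible S e = ∀ f → f ∈ S → VertexDisjoint (suc k) n e f

  compatible? : ∀ S e → Dec (Compatible S e)
  compatible? S e = Fin.all? λ f → (f ∈? S) →-dec Fin.all? λ i → ¬? (coord′ e i Fin.≟ coord′ f i)

  compatible⇒∉ : ∀ {S e} → Compatible S e → e ∉ S
  compatible⇒∉ {e = e} comp e∈S = comp e e∈S zero refl

  matching-∪ : ∀ {r S e} → Matching r S → Compatible S e → Matching (suc r) (S ∪ ⁅ e ⁆)
  matching-∪ {r} {S} {e} (size , disj) comp = trans (∣p∪⁅x⁆∣ S (compatible⇒∉ comp)) (cong suc size) , disjoint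
    where
    disjoint : ∀ f g → f ∈ S ∪ ⁅ e ⁆ → g ∈ S ∪ ⁅ e ⁆ → f ≢ g → VertexDisjoint (suc k) n f g
    disjoint f g f∈ g∈ f≢g i with x∈p∪q⁻ S ⁅ e ⁆ f∈ | x∈p∪q⁻ S ⁅ e ⁆ g∈
    ... | inj₁ f∈S | inj₁ g∈S = disj f g f∈S g∈S f≢g i
    ... | inj₁ f∈S | inj₂ g∈e rewrite x∈⁅y⁆⇒x≡y e g∈e = comp f f∈S i ∘ sym
    ... | inj₂ f∈e | inj₁ g∈S rewrite x∈⁅y⁆⇒x≡y e f∈e = comp g g∈S i
    ... | inj₂ f∈e | inj₂ g∈e = contradiction (trans (x∈⁅y⁆⇒x≡y e f∈e) (sym (x∈⁅y⁆⇒x≡y e g∈e))) f≢g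

  ⊆-compatible : ∀ {r S M e} → Matching r M → S ⊆ M → e ∈ M → e ∉ S → Compatible S e
  ⊆-compatible {S = S} (_ , disj) S⊆M e∈M e∉S f f∈S = disj _ f e∈M (S⊆M f∈S) λ { refl → e∉S f∈S }

  -- The degree in `S` of vertex `v` of part `j`.
  load : EdgeSet (suc k) n → Fin (suc k) → Fin n → ℕ
  load S j v = ∑ edges (λ e → 𝟙 ((e ∈? S) ×-dec (v Fin.≟ coord′ e j)))

  load≡0⁻ : ∀ S j v → load S j v ≡ 0 → ∀ e → e ∈ S → v ≢ coord′ e j
  load≡0⁻ S j v eq e e∈S v≡ = contradiction
    (≤-trans (≤-reflexive (sym (𝟙-yes ((e ∈? S) ×-dec (v Fin.≟ coord′ e j)) (e∈S , v≡))))
             (∑-term (λ e → 𝟙 ((e ∈? S) ×-dec (v Fin.≟ coord′ e j))) (∈-allFin e)))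
    (<⇒≱ (s≤s (≤-reflexive eq)))

  load≡0⁺ : ∀ S j v → (∀ e → e ∈ S → v ≢ coord′ e j) → load S j v ≡ 0
  load≡0⁺ S j v h = ∑-zero edges λ e → 𝟙-no ((e ∈? S) ×-dec (v Fin.≟ coord′ e j)) λ { (e∈ , eq) → h e e∈ eq }

  load≤1 : ∀ {r S} → Matching r S → ∀ j v → load S j v ≤ 1
  load≤1 {S = S} (_ , disj) j v = ∑-subsingleton Fin._≟_ (λ e → (e ∈? S) ×-dec (v Fin.≟ coord′ e j)) (Unique.allFin⁺ _) same
    where
    same : ∀ {e f} → e ∈ S × v ≡ coord′ e j → f ∈ S × v ≡ coord′ f j → e ≡ f
    same {e} {f} (e∈ , v≡e) (f∈ , v≡f) with e Fin.≟ f
    ... | yes e≡f = e≡f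
    ... | no e≢f = contradiction (trans (sym v≡e) v≡f) (disj e f e∈ f∈ e≢f j)

  ∑-load-weighted : ∀ S j (w : Fin n → ℕ) →
    ∑ (allFin n) (λ v → load S j v * w v) ≡ ∑ edges (λ e → 𝟙 (e ∈? S) * w (coord′ e j))
  ∑-load-weighted S j w = begin-equality
    ∑ (allFin n) (λ v → load S j v * w v)
      ≡⟨ ∑-cong (allFin n) (λ v → sym (∑-*ʳ edges _ (w v))) ⟩
    ∑ (allFin n) (λ v → ∑ edges (λ e → 𝟙 ((e ∈? S) ×-dec (v Fin.≟ coord′ e j)) * w v))
      ≡⟨ ∑-swap (allFin n) edges _ ⟩
    ∑ edges (λ e → ∑ (allFin n) (λ v → 𝟙 ((e ∈? S) ×-dec (v Fin.≟ coord′ e j)) * w v))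
      ≡⟨ ∑-cong edges (λ e → trans (∑-cong (allFin n) λ v → trans (cong (_* w v) (𝟙-× (e ∈? S) (v Fin.≟ coord′ e j)))
           (*-assoc (𝟙 (e ∈? S)) _ (w v))) (trans (∑-*ˡ (allFin n) (𝟙 (e ∈? S)) _)
           (cong (𝟙 (e ∈? S) *_) (∑-δ Fin._≟_ (Unique.allFin⁺ n) (∈-allFin (coord′ e j)) w)))) ⟩
    ∑ edges (λ e → 𝟙 (e ∈? S) * w (coord′ e j)) ∎

  ∑-load : ∀ S j → ∑ (allFin n) (load S j) ≡ ∣ S ∣
  ∑-load S j = begin-equality
    ∑ (allFin n) (load S j)                       ≡⟨ ∑-cong (allFin n) (λ v → sym (*-identityʳ _)) ⟩
    ∑ (allFin n) (λ v → load S j v * 1)           ≡⟨ ∑-load-weighted S j (λ _ → 1) ⟩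
    ∑ edges (λ e → 𝟙 (e ∈? S) * 1)                ≡⟨ ∑-cong edges (λ e → *-identityʳ _) ⟩
    ∑ edges (λ e → 𝟙 (e ∈? S))                    ≡⟨ ∑-∈ S ⟩
    ∣ S ∣                                         ∎

  ∑-one-Fin : ∑ (allFin n) (λ _ → 1) ≡ n
  ∑-one-Fin = trans (∑-one (allFin n)) (length-tabulate {n = n} λ i → i)

  ∑-uncovered : ∀ {r S} → Matching r S → ∀ j → ∑ (allFin n) (λ v → 𝟙 (load S j v ≟ 0)) + r ≡ n
  ∑-uncovered {r} {S} M j = begin-equality
    ∑ (allFin n) (λ v → 𝟙 (load S j v ≟ 0)) + r
      ≡⟨ cong (∑ (allFin n) (λ v → 𝟙 (load S j v ≟ 0)) +_) (trans (sym (proj₁ M)) (sym (∑-load S j))) ⟩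
    ∑ (allFin n) (λ v → 𝟙 (load S j v ≟ 0)) + ∑ (allFin n) (load S j)
      ≡⟨ sym (∑-+ (allFin n) _ _) ⟩
    ∑ (allFin n) (λ v → 𝟙 (load S j v ≟ 0) + load S j v)
      ≡⟨ ∑-cong (allFin n) (λ v → complement (load S j v) (load≤1 M j v)) ⟩
    ∑ (allFin n) (λ _ → 1)
      ≡⟨ ∑-one-Fin ⟩
    n ∎
    where
    complement : ∀ x → x ≤ 1 → 𝟙 (x ≟ 0) + x ≡ 1
    complement zero _ = refl
    complement (suc zero) _ = refl
    complement (suc (suc _)) (s≤s ())

  -- The `n` loads in a part are at most 1 and add up to `n`, so none can fall short.
  load≡1 : ∀ {M} → Matching n M → ∀ j v → load M j v ≡ 1
  load≡1 {M} perfect j v = ∑-saturated (load≤1 perfect j)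
    (≤-reflexive (trans ∑-one-Fin (trans (sym (proj₁ perfect)) (sym (∑-load M j))))) (∈-allFin v)

  ∣matching∣≤n : ∀ {r S} → Matching r S → r ≤ n
  ∣matching∣≤n {r} M = ≤-trans (m≤n+m r _) (≤-reflexive (∑-uncovered M zero))

  perfect⊇? : ∀ S M → Dec (Matching n M × S ⊆ M)
  perfect⊇? S M = matching? n M ×-dec (S ⊆? M)

  supers : EdgeSet (suc k) n → ℕ
  supers S = ∑ (subsets (n ^ suc k)) (λ M → 𝟙 (perfect⊇? S M))

  ∪⁅⁆-⊆⁻ : ∀ {S M : EdgeSet (suc k) n} e → S ∪ ⁅ e ⁆ ⊆ M → S ⊆ M × e ∈ M
  ∪⁅⁆-⊆⁻ {S} e sub = (sub ∘ p⊆p∪q ⁅ e ⁆) , sub (q⊆p∪q S ⁅ e ⁆ (x∈⁅x⁆ e))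

  ∪⁅⁆-⊆⁺ : ∀ {S M : EdgeSet (suc k) n} {e} → S ⊆ M → e ∈ M → S ∪ ⁅ e ⁆ ⊆ M
  ∪⁅⁆-⊆⁺ {S} {M} {e} S⊆M e∈M = ∪-⊆ S ⁅ e ⁆ M S⊆M (⁅x⁆⊆ e∈M)

  -- Every perfect matching has exactly one edge at vertex `i` of part `zero`; the count is sorted
  -- by that edge.
  supers-split : ∀ S i → supers S ≡ ∑ edges (λ e → 𝟙 (i Fin.≟ coord′ e zero) * supers (S ∪ ⁅ e ⁆))
  supers-split S i = begin-equality
    supers S
      ≡⟨ ∑-cong (subsets (n ^ suc k)) (λ M → pointwise M) ⟩
    ∑ (subsets (n ^ suc k)) (λ M → ∑ edges (λ e → 𝟙 (i Fin.≟ coord′ e zero) * 𝟙 (perfect⊇? (S ∪ ⁅ e ⁆) M)))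
      ≡⟨ ∑-swap (subsets (n ^ suc k)) edges _ ⟩
    ∑ edges (λ e → ∑ (subsets (n ^ suc k)) (λ M → 𝟙 (i Fin.≟ coord′ e zero) * 𝟙 (perfect⊇? (S ∪ ⁅ e ⁆) M)))
      ≡⟨ ∑-cong edges (λ e → ∑-*ˡ (subsets (n ^ suc k)) (𝟙 (i Fin.≟ coord′ e zero)) _) ⟩
    ∑ edges (λ e → 𝟙 (i Fin.≟ coord′ e zero) * supers (S ∪ ⁅ e ⁆)) ∎
    where
    pointwise : ∀ M → 𝟙 (perfect⊇? S M) ≡ ∑ edges (λ e → 𝟙 (i Fin.≟ coord′ e zero) * 𝟙 (perfect⊇? (S ∪ ⁅ e ⁆) M))
    pointwise M = aux (perfect⊇? S M)
      where
      aux : (d : Dec (Matching n M × S ⊆ M)) →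
            𝟙 d ≡ ∑ edges (λ e → 𝟙 (i Fin.≟ coord′ e zero) * 𝟙 (perfect⊇? (S ∪ ⁅ e ⁆) M))
      aux (no ¬p) = sym (∑-zero edges λ e → trans (cong (𝟙 (i Fin.≟ coord′ e zero) *_)
        (𝟙-no (perfect⊇? (S ∪ ⁅ e ⁆) M) λ { (perf , sub) → ¬p (perf , λ {x} → proj₁ (∪⁅⁆-⊆⁻ e sub) {x}) }))
        (*-zeroʳ (𝟙 (i Fin.≟ coord′ e zero))))
      aux (yes (perf , S⊆M)) = trans (sym (load≡1 perf zero i)) (∑-cong edges λ e →
        trans (𝟙-× (e ∈? M) (i Fin.≟ coord′ e zero)) (trans (*-comm (𝟙 (e ∈? M)) _)
        (cong (𝟙 (i Fin.≟ coord′ e zero) *_) (𝟙-cong (e ∈? M) (perfect⊇? (S ∪ ⁅ e ⁆) M)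
          (λ e∈M → perf , λ {x} → ∪⁅⁆-⊆⁺ S⊆M e∈M {x}) (λ { (_ , sub) → proj₂ (∪⁅⁆-⊆⁻ {S} e sub) })))))

  supers-incompatible : ∀ {S e} → e ∉ S → ¬ Compatible S e → supers (S ∪ ⁅ e ⁆) ≡ 0
  supers-incompatible {S} {e} e∉S ¬comp = ∑-zero (subsets (n ^ suc k)) λ M → 𝟙-no (perfect⊇? (S ∪ ⁅ e ⁆) M)
    λ { (perf , sub) → let S⊆M , e∈M = ∪⁅⁆-⊆⁻ {S} e sub in ¬comp (⊆-compatible perf S⊆M e∈M e∉S) }

  -- Induction on the number `d` of missing edges. Fix an uncovered vertex of part `zero`: its edge
  -- may use any of the `d` uncovered vertices in each of the other `k` parts, so each step
  -- contributes a factor `d ^ k`. With no edge missing, `S` is its own only extension.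
  supers-matching : ∀ d {r S} → Matching r S → d + r ≡ n → supers S ≡ (d !) ^ k
  supers-matching zero {r} {S} M refl = trans (∑-cong (subsets (n ^ suc k)) λ M′ → trans
      (𝟙-cong (perfect⊇? S M′) (M′ ≟ˢ S) (λ { (perf , S⊆M′) → sym (fills (λ {x} → S⊆M′ {x}) (trans (proj₁ perf) (sym (proj₁ M)))) })
        (λ { refl → M , λ x → x })) refl)
    (trans (∑-δ-one _≟ˢ_ (subsets-unique (n ^ suc k)) (∈-subsets S)) (sym (^-zeroˡ k)))
    where
    fills : ∀ {M′} → S ⊆ M′ → ∣ M′ ∣ ≡ ∣ S ∣ → S ≡ M′
    fills {M′} S⊆M′ eq = ⊆-antisym S⊆M′ λ {x} x∈M′ → case x ∈? S of λ
      { (yes x∈S) → x∈S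
      ; (no x∉S) → contradiction (p⊂q⇒∣p∣<∣q∣ (S⊆M′ , x , x∈M′ , x∉S)) (<-irrefl (sym eq)) }
  supers-matching (suc d) {r} {S} M d+r≡n = begin-equality
    supers S
      ≡⟨ supers-split S i ⟩
    ∑ edges (λ e → 𝟙 (i Fin.≟ coord′ e zero) * supers (S ∪ ⁅ e ⁆))
      ≡⟨ ∑-cong edges pointwise ⟩
    ∑ edges (λ e → ∏ (suc k) (λ j → w j (coord′ e j)) * (d !) ^ k)
      ≡⟨ ∑-*ʳ edges _ ((d !) ^ k) ⟩
    ∑ edges (λ e → ∏ (suc k) (λ j → w j (coord′ e j))) * (d !) ^ k
      ≡⟨ cong (_* (d !) ^ k) (∑-∏ n (suc k) w) ⟩
    ∑ (allFin n) (λ v → 𝟙 (v Fin.≟ i)) * ∏ k (λ j → ∑ (allFin n) (w (suc j))) * (d !) ^ k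
      ≡⟨ cong (_* (d !) ^ k) (cong₂ _*_
           (∑-δ-one Fin._≟_ (Unique.allFin⁺ n) (∈-allFin i))
           (trans (∏-cong k λ j → count (suc j)) (∏-const k (suc d)))) ⟩
    1 * suc d ^ k * (d !) ^ k
      ≡⟨ trans (cong (_* (d !) ^ k) (+-identityʳ (suc d ^ k))) (sym (^-distribʳ-* k (suc d) (d !))) ⟩
    (suc d * d !) ^ k ∎
    where
    count : ∀ j → ∑ (allFin n) (λ v → 𝟙 (load S j v ≟ 0)) ≡ suc d
    count j = +-cancelʳ-≡ r _ _ (trans (∑-uncovered M j) (sym d+r≡n))
    free : ∃[ i ] load S zero i ≡ 0
    free = case ∑-<⇒∃ (allFin n) (λ _ → 0) (λ v → 𝟙 (load S zero v ≟ 0))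
                  (subst₂ _<_ (sym (∑-zero (allFin n) λ _ → refl)) (sym (count zero)) (s≤s z≤n)) of
      λ { (i , _ , pos) → i , 𝟙-true (load S zero i ≟ 0) pos }
    i = proj₁ free
    -- The product of these weights over the coordinates of `e` indicates that `e` passes through
    -- `i` and is compatible with `S`; `∑-∏` then counts such edges.
    w : Fin (suc k) → Fin n → ℕ
    w zero v = 𝟙 (v Fin.≟ i)
    w (suc j) v = 𝟙 (load S (suc j) v ≟ 0)
    pointwise : ∀ e → 𝟙 (i Fin.≟ coord′ e zero) * supers (S ∪ ⁅ e ⁆) ≡ ∏ (suc k) (λ j → w j (coord′ e j)) * (d !) ^ k
    pointwise e with i Fin.≟ coord′ e zero
    ... | no i≢ = sym (cong (_* (d !) ^ k) (∏-vanish (suc k) (λ j → w j (coord′ e j)) zero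
                    (𝟙-no (coord′ e zero Fin.≟ i) (i≢ ∘ sym))))
    ... | yes i≡ with compatible? S e
    ...   | yes comp = begin-equality
            1 * supers (S ∪ ⁅ e ⁆)
              ≡⟨ cong (1 *_) (supers-matching d (matching-∪ M comp) (trans (+-suc d r) d+r≡n)) ⟩
            1 * (d !) ^ k
              ≡⟨ cong (_* (d !) ^ k) (sym (trans (∏-cong (suc k) {λ j → w j (coord′ e j)} {λ _ → 1} ones) (trans
                        (∏-const (suc k) 1) (^-zeroˡ (suc k))))) ⟩
            ∏ (suc k) (λ j → w j (coord′ e j)) * (d !) ^ k ∎
      where
      ones : ∀ j → w j (coord′ e j) ≡ 1
      ones zero = 𝟙-yes (coord′ e zero Fin.≟ i) (sym i≡)
      ones (suc j) = 𝟙-yes (load S (suc j) (coord′ e (suc j)) ≟ 0)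
        (load≡0⁺ S (suc j) (coord′ e (suc j)) λ f f∈S → comp f f∈S (suc j))
    -- Both sides vanish: `S` covers some coordinate of `e`, and not the one in part `zero`, since
    -- `i` is uncovered.
    ...   | no ¬comp = trans (+-identityʳ _) (trans (supers-incompatible e∉S ¬comp)
                         (sym (cong (_* (d !) ^ k) (vanish (Fin.any? λ j → ¬? (load S j (coord′ e j) ≟ 0))))))
      where
      e∉S : e ∉ S
      e∉S e∈S = load≡0⁻ S zero i (proj₂ free) e e∈S i≡
      vanish : Dec (∃[ j ] load S j (coord′ e j) ≢ 0) → ∏ (suc k) (λ j → w j (coord′ e j)) ≡ 0
      vanish (yes (zero , ≢0)) = contradiction (subst (λ v → load S zero v ≡ 0) i≡ (proj₂ free)) ≢0
      vanish (yes (suc j , ≢0)) = ∏-vanish (suc k) (λ j → w j (coord′ e j)) (suc j)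
        (𝟙-no (load S (suc j) (coord′ e (suc j)) ≟ 0) ≢0)
      vanish (no all0) = contradiction (λ f f∈S j → load≡0⁻ S j (coord′ e j)
        (case load S j (coord′ e j) ≟ 0 of λ { (yes ≡0) → ≡0 ; (no ≢0) → contradiction (j , ≢0) all0 }) f f∈S) ¬comp

-- Perfect matchings through `C` that meet a given one outside `C`

module Hitting (k n : ℕ) where

  open ≤-Reasoning
  open Matchings k n

  private
    edges : List (Edge (suc k) n)
    edges = allFin (n ^ suc k)

    coord′ : Edge (suc k) n → Fin (suc k) → Fin n
    coord′ = coord {suc k} {n}

  hitting? : ∀ C M A → Dec ((Matching n A × C ⊆ A) × Nonempty ((A ∩ M) ─ C))
  hitting? C M A = perfect⊇? C A ×-dec nonempty? ((A ∩ M) ─ C)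

  hitters : EdgeSet (suc k) n → EdgeSet (suc k) n → ℕ
  hitters C M = ∑ (subsets (n ^ suc k)) (λ A → 𝟙 (hitting? C M A))

  targets : EdgeSet (suc k) n → EdgeSet (suc k) n → List (Edge (suc k) n)
  targets C M = filter (λ e → (e ∈? M) ×-dec compatible? C e) edges

  -- The part-`zero` vertex of a target is not covered by `C`, and the perfect matching `M` has just
  -- one edge at each such vertex.
  ∣targets∣ : ∀ {r C M} → Matching r C → Matching n M → length (targets C M) + r ≤ n
  ∣targets∣ {r} {C} {M} matC perf = begin
    length (targets C M) + r
      ≡⟨ cong (_+ r) (length-filter (λ e → (e ∈? M) ×-dec compatible? C e) edges) ⟩
    ∑ edges (λ e → 𝟙 ((e ∈? M) ×-dec compatible? C e)) + r
      ≤⟨ +-monoˡ-≤ r (∑-mono edges λ {e} _ → ≤-trans (≤-reflexive (𝟙-× (e ∈? M) (compatible? C e)))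
           (*-monoʳ-≤ (𝟙 (e ∈? M)) (𝟙-mono (compatible? C e) (load C zero (coord′ e zero) ≟ 0)
             λ comp → load≡0⁺ C zero (coord′ e zero) λ f f∈C → comp f f∈C zero))) ⟩
    ∑ edges (λ e → 𝟙 (e ∈? M) * 𝟙 (load C zero (coord′ e zero) ≟ 0)) + r
      ≡⟨ cong (_+ r) (sym (∑-load-weighted M zero λ v → 𝟙 (load C zero v ≟ 0))) ⟩
    ∑ (allFin n) (λ v → load M zero v * 𝟙 (load C zero v ≟ 0)) + r
      ≡⟨ cong (_+ r) (∑-cong (allFin n) λ v → trans (cong (_* 𝟙 (load C zero v ≟ 0)) (load≡1 perf zero v)) (*-identityˡ _)) ⟩
    ∑ (allFin n) (λ v → 𝟙 (load C zero v ≟ 0)) + r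
      ≡⟨ ∑-uncovered matC zero ⟩
    n ∎

  hitting⇒target : ∀ {C M A} → (Matching n A × C ⊆ A) × Nonempty ((A ∩ M) ─ C) →
                   ∃[ e ] e ∈ˡ targets C M × Matching n A × C ∪ ⁅ e ⁆ ⊆ A
  hitting⇒target {C} {M} {A} ((perf , C⊆A) , e , e∈) =
    let e∈A , e∈M = x∈p∩q⁻ A M (p─q⊆p (A ∩ M) C e∈)
    in e , ∈-filter⁺ (λ e → (e ∈? M) ×-dec compatible? C e) (∈-allFin e)
             (e∈M , ⊆-compatible perf C⊆A e∈A (x∈p─q⇒x∉q (A ∩ M) C e∈))
         , perf , λ {x} → ∪⁅⁆-⊆⁺ {C} {A} C⊆A e∈A {x}

  -- A union bound over the targets, in which the matchings through both e₀ and e₁ are counted twice.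
  hitters-bound : ∀ {r C M d} → Matching r C → Matching n M → suc (suc d) + r ≡ n →
                  hitters C M + (d !) ^ k ≤ suc (suc d) * ((suc d) !) ^ k
  hitters-bound {r} {C} {M} {d} matC perfM eq = cases (targets C M) refl
    where
    M₁ M₂ : ℕ
    M₁ = ((suc d) !) ^ k
    M₂ = (d !) ^ k
    M₂≤M₁ : M₂ ≤ M₁
    M₂≤M₁ = ^-monoˡ-≤ k (m≤m+n (d !) (d * d !))
    target⁻ : ∀ {e} → e ∈ˡ targets C M → e ∈ M × Compatible C e
    target⁻ {e} e∈ = proj₂ (∈-filter⁻ (λ e → (e ∈? M) ×-dec compatible? C e) {xs = edges} e∈)
    supers-target : ∀ {e} → e ∈ˡ targets C M → supers (C ∪ ⁅ e ⁆) ≡ M₁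
    supers-target e∈ = supers-matching (suc d) (matching-∪ matC (proj₂ (target⁻ e∈))) (trans (+-suc (suc d) r) eq)
    number : length (targets C M) ≤ suc (suc d)
    number = +-cancelʳ-≤ r _ _ (≤-trans (∣targets∣ matC perfM) (≤-reflexive (sym eq)))
    ∑-supers : ∑ (targets C M) (λ e → supers (C ∪ ⁅ e ⁆)) ≤ suc (suc d) * M₁
    ∑-supers = begin
      ∑ (targets C M) (λ e → supers (C ∪ ⁅ e ⁆)) ≡⟨ ∑-cong-∈ (targets C M) supers-target ⟩
      ∑ (targets C M) (λ _ → M₁)                 ≡⟨ ∑-const (targets C M) M₁ ⟩
      length (targets C M) * M₁                  ≤⟨ *-monoˡ-≤ M₁ number ⟩
      suc (suc d) * M₁                           ∎
    covered : ∀ A → 𝟙 (hitting? C M A) ≤ ∑ (targets C M) (λ e → 𝟙 (perfect⊇? (C ∪ ⁅ e ⁆) A))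
    covered A = 𝟙-≤ (hitting? C M A) λ hit → let e , e∈ , perf , sub = hitting⇒target {C} {M} {A} hit in
      ≤-trans (≤-reflexive (sym (𝟙-yes (perfect⊇? (C ∪ ⁅ e ⁆) A) (perf , λ {x} → sub {x}))))
        (∑-term (λ e → 𝟙 (perfect⊇? (C ∪ ⁅ e ⁆) A)) e∈)
    union : hitters C M ≤ ∑ (targets C M) (λ e → supers (C ∪ ⁅ e ⁆))
    union = ≤-trans (∑-mono (subsets (n ^ suc k)) λ {A} _ → covered A)
      (≤-reflexive (∑-swap (subsets (n ^ suc k)) (targets C M) _))
    -- With fewer than two targets the union bound leaves a spare `M₁`, which absorbs `M₂`; only two
    -- or more targets need the double counting.
    cases : ∀ es → targets C M ≡ es → hitters C M + M₂ ≤ suc (suc d) * M₁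
    cases [] es = begin
      hitters C M + M₂ ≤⟨ +-mono-≤ (≤-trans union (≤-reflexive (cong (λ es → ∑ es (λ e → supers (C ∪ ⁅ e ⁆))) es))) M₂≤M₁ ⟩
      M₁               ≤⟨ m≤m+n M₁ _ ⟩
      suc (suc d) * M₁ ∎
    cases (e ∷ []) es = begin
      hitters C M + M₂ ≤⟨ +-mono-≤ (≤-trans union (≤-reflexive (trans (cong (λ es → ∑ es (λ e → supers (C ∪ ⁅ e ⁆))) es)
                            (trans (+-identityʳ _) (supers-target (subst (e ∈ˡ_) (sym es) (here refl))))))) M₂≤M₁ ⟩
      M₁ + M₁          ≤⟨ +-monoʳ-≤ M₁ (m≤m+n M₁ _) ⟩
      suc (suc d) * M₁ ∎
    cases (e₀ ∷ e₁ ∷ rest) es = begin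
      hitters C M + M₂
        ≡⟨ cong (hitters C M +_) (sym (supers-matching d
             (matching-∪ (matching-∪ matC (proj₂ (target⁻ e₀∈))) comp₁) (trans (+-suc d (suc r)) (trans (cong suc (+-suc d r)) eq)))) ⟩
      hitters C M + supers ((C ∪ ⁅ e₀ ⁆) ∪ ⁅ e₁ ⁆)
        ≡⟨ sym (∑-+ (subsets (n ^ suc k)) _ _) ⟩
      ∑ (subsets (n ^ suc k)) (λ A → 𝟙 (hitting? C M A) + 𝟙 (perfect⊇? ((C ∪ ⁅ e₀ ⁆) ∪ ⁅ e₁ ⁆) A))
        ≤⟨ ∑-mono (subsets (n ^ suc k)) (λ {A} _ → pointwise A (perfect⊇? ((C ∪ ⁅ e₀ ⁆) ∪ ⁅ e₁ ⁆) A)) ⟩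
      ∑ (subsets (n ^ suc k)) (λ A → ∑ (targets C M) (λ e → 𝟙 (perfect⊇? (C ∪ ⁅ e ⁆) A)))
        ≡⟨ ∑-swap (subsets (n ^ suc k)) (targets C M) _ ⟩
      ∑ (targets C M) (λ e → supers (C ∪ ⁅ e ⁆))
        ≤⟨ ∑-supers ⟩
      suc (suc d) * M₁ ∎
      where
      e₀∈ : e₀ ∈ˡ targets C M
      e₀∈ = subst (e₀ ∈ˡ_) (sym es) (here refl)
      e₁∈ : e₁ ∈ˡ targets C M
      e₁∈ = subst (e₁ ∈ˡ_) (sym es) (there (here refl))
      e₀≢e₁ : e₀ ≢ e₁
      e₀≢e₁ with subst Unique es (Unique.filter⁺ (λ e → (e ∈? M) ×-dec compatible? C e) (Unique.allFin⁺ (n ^ suc k)))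
      ... | (e₀≢e₁ ∷ _) ∷ _ = e₀≢e₁
      comp₁ : Compatible (C ∪ ⁅ e₀ ⁆) e₁
      comp₁ f f∈ with x∈p∪q⁻ C ⁅ e₀ ⁆ f∈
      ... | inj₁ f∈C = proj₂ (target⁻ e₁∈) f f∈C
      ... | inj₂ f∈e₀ rewrite x∈⁅y⁆⇒x≡y e₀ f∈e₀ =
        proj₂ perfM e₁ e₀ (proj₁ (target⁻ e₁∈)) (proj₁ (target⁻ e₀∈)) (e₀≢e₁ ∘ sym)
      pointwise : ∀ A (both? : Dec (Matching n A × (C ∪ ⁅ e₀ ⁆) ∪ ⁅ e₁ ⁆ ⊆ A)) →
        𝟙 (hitting? C M A) + 𝟙 both? ≤ ∑ (targets C M) (λ e → 𝟙 (perfect⊇? (C ∪ ⁅ e ⁆) A))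
      pointwise A (no _) = ≤-trans (≤-reflexive (+-identityʳ _)) (covered A)
      pointwise A (yes (perf , sub)) = begin
        𝟙 (hitting? C M A) + 1
          ≤⟨ +-mono-≤ (𝟙≤1 (hitting? C M A)) (m≤m+n 1 _) ⟩
        1 + (1 + ∑ rest g)
          ≡⟨ cong₂ (λ x y → x + (y + ∑ rest g)) (sym (𝟙-yes (perfect⊇? (C ∪ ⁅ e₀ ⁆) A) (perf , λ {x} → proj₁ split {x})))
               (sym (𝟙-yes (perfect⊇? (C ∪ ⁅ e₁ ⁆) A)
                 (perf , λ {x} → ∪⁅⁆-⊆⁺ {C} {A} (proj₁ (∪⁅⁆-⊆⁻ {C} {A} e₀ (proj₁ split))) (proj₂ split) {x}))) ⟩
        ∑ (e₀ ∷ e₁ ∷ rest) g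
          ≡⟨ cong (λ es → ∑ es g) (sym es) ⟩
        ∑ (targets C M) g ∎
        where
        g : Edge (suc k) n → ℕ
        g e = 𝟙 (perfect⊇? (C ∪ ⁅ e ⁆) A)
        split = ∪⁅⁆-⊆⁻ {C ∪ ⁅ e₀ ⁆} {A} e₁ sub

-- Estimates

n<2^n : ∀ n → n < 2 ^ n
n<2^n zero = s≤s z≤n
n<2^n (suc n) = ≤-trans (+-mono-≤ (m^n>0 2 n) (n<2^n n)) (≤-reflexive (cong (2 ^ n +_) (sym (+-identityʳ _))))

log₂-bounds : ∀ n → 1 ≤ n → ∃[ p ] 2 ^ p ≤ n × n < 2 ^ suc p
log₂-bounds (suc zero) _ = 0 , ≤-refl , ≤-refl
log₂-bounds (suc n@(suc _)) _ with log₂-bounds n (s≤s z≤n)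
... | p , 2^p≤n , n<2^1+p with suc n <? 2 ^ suc p
...   | yes lt = p , ≤-trans 2^p≤n (n≤1+n n) , lt
...   | no ≮ = suc p , ≮⇒≥ ≮ , ≤-<-trans n<2^1+p (^-monoʳ-< 2 ≤-refl {suc p} {suc (suc p)} ≤-refl)

-- Write x as roughly e times q and use q < 2 ^ q.
x^e≤e^e*2^x : ∀ e .{{_ : NonZero e}} x → x ^ e ≤ e ^ e * 2 ^ x
x^e≤e^e*2^x e x = begin
  x ^ e                      ≤⟨ ^-monoˡ-≤ e x≤ ⟩
  (e * suc (x / e)) ^ e      ≤⟨ ^-monoˡ-≤ e (*-monoʳ-≤ e (n<2^n (x / e))) ⟩
  (e * 2 ^ (x / e)) ^ e      ≡⟨ ^-distribʳ-* e e (2 ^ (x / e)) ⟩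
  e ^ e * (2 ^ (x / e)) ^ e  ≡⟨ cong (e ^ e *_) (^-*-assoc 2 (x / e) e) ⟩
  e ^ e * 2 ^ (x / e * e)    ≤⟨ *-monoʳ-≤ (e ^ e) (^-monoʳ-≤ 2 (m/n*n≤m x e)) ⟩
  e ^ e * 2 ^ x              ∎
  where
  open ≤-Reasoning
  x≤ : x ≤ e * suc (x / e)
  x≤ = begin
    x                        ≡⟨ m≡m%n+[m/n]*n x e ⟩
    x % e + x / e * e        ≤⟨ +-monoˡ-≤ (x / e * e) (<⇒≤ (m%n<n x e)) ⟩
    e + x / e * e            ≡⟨ *-comm (suc (x / e)) e ⟩
    e * suc (x / e)          ∎

-- `x^e≤e^e*2^x` is applied with exponent `suc (3 * e)`, one above the degree of the left side; the
-- spare factor `suc p` exceeds the constants once `p` is at least the witness.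
polynomial≤exponential : ∀ a e → ∃[ B ] (∀ p → B ≤ p → (a * suc p ^ 3) ^ e ≤ 2 ^ p)
polynomial≤exponential a e = 2 * (a ^ e * c) , λ p B≤p → *-cancelˡ-≤ (2 * c) {{2c≢0}} (begin
  2 * c * (a * suc p ^ 3) ^ e         ≡⟨ cong (2 * c *_) (trans (^-distribʳ-* e a (suc p ^ 3)) (cong (a ^ e *_) (^-*-assoc (suc p) 3 e))) ⟩
  2 * c * (a ^ e * suc p ^ (3 * e))   ≡⟨ solve 3 (λ c a x → con 2 :* c :* (a :* x) := con 2 :*
            (a :* c) :* x) refl c (a ^ e) (suc p ^ (3 * e)) ⟩
  2 * (a ^ e * c) * suc p ^ (3 * e)   ≤⟨ *-monoˡ-≤ (suc p ^ (3 * e)) (≤-trans B≤p (n≤1+n p)) ⟩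
  suc p ^ suc (3 * e)                 ≤⟨ x^e≤e^e*2^x (suc (3 * e)) (suc p) ⟩
  c * (2 * 2 ^ p)                     ≡⟨ solve 2 (λ c x → c :* (con 2 :* x) := con 2 :* c :* x) refl c (2 ^ p) ⟩
  2 * c * 2 ^ p                       ∎)
  where
  open ≤-Reasoning
  open +-*-Solver
  c = suc (3 * e) ^ suc (3 * e)
  2c≢0 : NonZero (2 * c)
  2c≢0 = m*n≢0 2 c {{_}} {{m^n≢0 (suc (3 * e)) (suc (3 * e))}}

r^j*d!≤[j+d]! : ∀ {r d} j → r ≤ suc d → r ^ j * d ! ≤ (j + d) !
r^j*d!≤[j+d]! {r} {d} zero r≤ = ≤-reflexive (+-identityʳ (d !))
r^j*d!≤[j+d]! {r} {d} (suc j) r≤ = ≤-trans (≤-reflexive (*-assoc r (r ^ j) (d !)))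
  (*-mono-≤ (≤-trans r≤ (s≤s (m≤n+m d j))) (r^j*d!≤[j+d]! j r≤))

d!≤r^d : ∀ {r} d → d ≤ r → d ! ≤ r ^ d
d!≤r^d zero _ = ≤-refl
d!≤r^d (suc d) d<r = *-mono-≤ d<r (d!≤r^d d (<⇒≤ d<r))

-- The factors of `N !` above `r ^ 2` already give `(r ^ 2) ^ (N ∸ r ^ 2)`, and the hypothesis says
-- precisely that `2 * (N ∸ r ^ 2)` exceeds `N + u`.
r^[N+u]<N! : ∀ {r N u} → 2 ≤ r → 2 * r ^ 2 + u < N → r ^ (N + u) < N !
r^[N+u]<N! {r} {N} {u} 2≤r lt = case m≤n⇒∃[o]m+o≡n (<⇒≤ R<N) of λ { (j , refl) → begin-strict
    r ^ (r ^ 2 + j + u)      <⟨ ^-monoʳ-< r 2≤r (exponents j lt) ⟩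
    r ^ (2 * j)              ≡⟨ sym (^-*-assoc r 2 j) ⟩
    (r ^ 2) ^ j              ≡⟨ sym (*-identityʳ _) ⟩
    (r ^ 2) ^ j * 1          ≤⟨ *-monoʳ-≤ ((r ^ 2) ^ j) (1≤n! (r ^ 2)) ⟩
    (r ^ 2) ^ j * (r ^ 2) !  ≤⟨ r^j*d!≤[j+d]! j (n≤1+n _) ⟩
    (j + r ^ 2) !            ≡⟨ cong _! (+-comm j (r ^ 2)) ⟩
    (r ^ 2 + j) !            ∎ }
  where
  open ≤-Reasoning
  open +-*-Solver
  R<N : r ^ 2 < N
  R<N = ≤-<-trans (≤-trans (m≤n*m (r ^ 2) 2) (m≤m+n _ u)) lt
  exponents : ∀ j → 2 * r ^ 2 + u < r ^ 2 + j → r ^ 2 + j + u < 2 * j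
  exponents j lt = +-cancelˡ-< (r ^ 2) _ _ (begin-strict
    r ^ 2 + (r ^ 2 + j + u)  ≡⟨ solve 3 (λ x j u → x :+ (x :+ j :+ u) := con 2 :* x :+ u :+ j) refl (r ^ 2) j u ⟩
    2 * r ^ 2 + u + j        <⟨ +-monoˡ-< j lt ⟩
    r ^ 2 + j + j            ≡⟨ solve 2 (λ x j → x :+ j :+ j := x :+ con 2 :* j) refl (r ^ 2) j ⟩
    r ^ 2 + 2 * j            ∎)

-- r ^ (N + u ∸ d) * d ! decreases in d up to d = r and increases afterwards, so only the endpoints matter.
factorial-gap : ∀ {r N u s d} → 2 ≤ r → r ^ suc u < N → 2 * r ^ 2 + u < N → s + d ≡ N + u → d < N →
                r ^ s * d ! < N !
factorial-gap {r} {N} {u} {s} {d} 2≤r first last eq d<N with d ≤? r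
... | yes d≤r = begin-strict
  r ^ s * d !      ≤⟨ *-monoʳ-≤ (r ^ s) (d!≤r^d d d≤r) ⟩
  r ^ s * r ^ d    ≡⟨ trans (sym (^-distribˡ-+-* r s d)) (cong (r ^_) eq) ⟩
  r ^ (N + u)      <⟨ r^[N+u]<N! 2≤r last ⟩
  N !              ∎
  where open ≤-Reasoning
... | no d≰r = case m≤n⇒∃[o]m+o≡n d<N of λ { (j , refl) → begin-strict
    r ^ s * d !                        ≡⟨ cong (λ s → r ^ s * d !) (+-cancelʳ-≡ d s (suc u + j)
                                            (trans eq (solve 3 (λ d j u → con 1 :+ d :+ j :+ u := con 1 :+ u :+ j :+ d) refl d j u))) ⟩
    r ^ (suc u + j) * d !              ≡⟨ trans (cong (_* d !) (^-distribˡ-+-* r (suc u) j)) (*-assoc (r ^ suc u) (r ^ j) (d !)) ⟩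
    r ^ suc u * (r ^ j * d !)          ≤⟨ *-monoʳ-≤ (r ^ suc u) (r^j*d!≤[j+d]! j (≤-trans (<⇒≤ (≰⇒> d≰r)) (n≤1+n d))) ⟩
    r ^ suc u * (j + d) !              <⟨ *-monoˡ-< ((j + d) !) {{(j + d) !≢0}} first ⟩
    (suc d + j) * (j + d) !            ≡⟨ cong (λ x → (suc d + j) * x !) (+-comm j d) ⟩
    (suc d + j) !                      ∎ }
  where
  open ≤-Reasoning
  open +-*-Solver

factorial-gap-^ : ∀ {r N u s d} k .{{_ : NonZero k}} → 2 ≤ r → r ^ suc u < N → 2 * r ^ 2 + u < N → s + d ≡ N + u → d < N →
                  (d !) ^ k * r ^ s < (N !) ^ k
factorial-gap-^ {r} {N} {u} {s} {d} k 2≤r first last eq d<N = begin-strict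
  (d !) ^ k * r ^ s          ≤⟨ *-monoʳ-≤ ((d !) ^ k) r^s≤ ⟩
  (d !) ^ k * (r ^ s) ^ k    ≡⟨ trans (*-comm ((d !) ^ k) _) (sym (^-distribʳ-* k (r ^ s) (d !))) ⟩
  (r ^ s * d !) ^ k          <⟨ ^-monoˡ-< k (factorial-gap 2≤r first last eq d<N) ⟩
  (N !) ^ k                  ∎
  where
  open ≤-Reasoning
  instance
    r≢0 : NonZero r
    r≢0 = >-nonZero (<-trans (s≤s z≤n) 2≤r)
    r^s≢0 : NonZero (r ^ s)
    r^s≢0 = m^n≢0 r s
  r^s≤ : r ^ s ≤ (r ^ s) ^ k
  r^s≤ = ≤-trans (≤-reflexive (sym (^-identityʳ (r ^ s)))) (^-monoʳ-≤ (r ^ s) (>-nonZero⁻¹ k))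

-- `m` is the number of colouring rounds, enough to shrink a perfect matching to nothing since
-- `n<2^m`. The fields `first` and `last` are the endpoint conditions of `factorial-gap` with
-- `N = n ∸ u`; they are applied at `u = t` and `u = 2 + t`.
record LargeEnough (t n m : ℕ) : Set where
  field
    1≤m        : 1 ≤ m
    n<2^m      : n < 2 ^ m
    room       : 2 + t ≤ n
    2≤rate     : 2 ≤ rate m
    cores-fit  : 2 * (2 + t) ≤ rate m
    first      : ∀ u → u ≤ 2 + t → rate m ^ suc u < n ∸ u
    last       : ∀ u → u ≤ 2 + t → 2 * rate m ^ 2 + u < n ∸ u

rate-cubic : ∀ m → rate m ≡ 80 * m ^ 3
rate-cubic = solve 1 (λ m → (con 2 :* (m :+ m)) :^ 2 :* (con 5 :* m) := con 80 :* m :^ 3) refl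
  where open +-*-Solver

5*m≤rate : ∀ m .{{_ : NonZero m}} → 5 * m ≤ rate m
5*m≤rate m = m≤n*m (5 * m) ((2 * (m + m)) ^ 2) {{m^n≢0 (2 * (m + m)) 2 {{m*n≢0 2 (m + m) {{_}} {{>-nonZero (≤-trans (>-nonZero⁻¹ m) (m≤m+n m m))}}}}}}

large-enough : ∀ t → ∃[ n₀ ] t ≤ n₀ × (∀ n → n₀ ≤ n → ∃[ m ] LargeEnough t n m)
large-enough t = 2 ^ b , t≤2^b , λ n n₀≤n → case log₂-bounds n (≤-trans (m^n>0 2 b) n₀≤n) of
    λ { (p , 2^p≤n , n<2^m) → suc p , construct n p n<2^m (exponent n p n₀≤n n<2^m) 2^p≤n }
  where
  open ≤-Reasoning
  -- The worst case of `first`, at `u = 2 + t`, involves the power `3 + t`; one more power absorbs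
  -- the lower-order terms.
  p₀ = proj₁ (polynomial≤exponential 80 (4 + t))
  -- The summand `2 + t` forces `p ≥ 2 + t`, which makes the rate exceed twice the largest core size
  -- considered and also gives `room`.
  b = p₀ + (2 + t)
  t≤2^b : t ≤ 2 ^ b
  t≤2^b = ≤-trans (≤-trans (m≤n+m t 2) (m≤n+m (2 + t) p₀)) (<⇒≤ (n<2^n b))
  exponent : ∀ n p → 2 ^ b ≤ n → n < 2 ^ suc p → b ≤ p
  exponent n p n₀≤n n<2^m = ≮⇒≥ λ p<b → <⇒≱ n<2^m (≤-trans (^-monoʳ-≤ 2 p<b) n₀≤n)
  construct : ∀ n p → n < 2 ^ suc p → b ≤ p → 2 ^ p ≤ n → LargeEnough t n (suc p)
  construct n p n<2^m b≤p 2^p≤n = record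
    { 1≤m = s≤s z≤n
    ; n<2^m = n<2^m
    ; room = ≤-trans (m≤n+m (2 + t) p₀) (≤-trans b≤p (≤-trans (<⇒≤ (n<2^n p)) 2^p≤n))
    ; 2≤rate = ≤-trans (s≤s (s≤s z≤n)) large
    ; cores-fit = ≤-trans (n≤1+n _) large
    ; first = λ u u≤ → m+n≤o⇒m≤o∸n _ (begin
        suc (ρ ^ suc u) + u        ≡⟨ sym (+-suc (ρ ^ suc u) u) ⟩
        ρ ^ suc u + suc u          ≤⟨ +-mono-≤ (^-monoʳ-≤ ρ (s≤s u≤)) (≤-trans (≤-trans (s≤s (≤-trans u≤ (m≤m+n
                  (2 + t) _))) large) (self (2 + t))) ⟩
        ρ ^ (3 + t) + ρ ^ (3 + t)  ≡⟨ cong (ρ ^ (3 + t) +_) (sym (+-identityʳ _)) ⟩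
        2 * ρ ^ (3 + t)            ≤⟨ *-monoˡ-≤ (ρ ^ (3 + t)) (≤-trans (s≤s (s≤s z≤n)) large) ⟩
        ρ ^ (4 + t)                ≤⟨ ρ^≤n ⟩
        n                          ∎)
    ; last = λ u u≤ → m+n≤o⇒m≤o∸n _ (begin
        suc (2 * ρ ^ 2 + u) + u    ≡⟨ trans (cong suc (+-assoc (2 * ρ ^ 2) u u)) (sym (+-suc (2 * ρ ^ 2) (u + u))) ⟩
        2 * ρ ^ 2 + suc (u + u)    ≤⟨ +-monoʳ-≤ (2 * ρ ^ 2) (≤-trans (≤-trans (s≤s (+-mono-≤ u≤ (≤-trans u≤
                  (m≤m+n (2 + t) 0)))) large) (self 1)) ⟩
        2 * ρ ^ 2 + ρ ^ 2          ≡⟨ +-comm (2 * ρ ^ 2) (ρ ^ 2) ⟩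
        3 * ρ ^ 2                  ≤⟨ *-monoˡ-≤ (ρ ^ 2) (≤-trans (s≤s (s≤s (s≤s z≤n))) large) ⟩
        ρ ^ 3                      ≤⟨ ^-monoʳ-≤ ρ (m≤m+n 3 (1 + t)) ⟩
        ρ ^ (3 + (1 + t))          ≡⟨ cong (ρ ^_) (+-suc 3 t) ⟩
        ρ ^ (4 + t)                ≤⟨ ρ^≤n ⟩
        n                          ∎) }
    where
    ρ = rate (suc p)
    large : suc (2 * (2 + t)) ≤ ρ
    large = begin
      suc (2 * (2 + t))            ≤⟨ +-monoˡ-≤ (2 * (2 + t)) {1} {2 + t} (s≤s z≤n) ⟩
      3 * (2 + t)                  ≤⟨ *-monoˡ-≤ (2 + t) {3} {5} (s≤s (s≤s (s≤s z≤n))) ⟩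
      5 * (2 + t)                  ≤⟨ *-monoʳ-≤ 5 (≤-trans (m≤n+m (2 + t) p₀) (≤-trans b≤p (n≤1+n p))) ⟩
      5 * suc p                    ≤⟨ 5*m≤rate (suc p) ⟩
      ρ                            ∎
    instance
      ρ≢0 : NonZero ρ
      ρ≢0 = >-nonZero (≤-trans (s≤s z≤n) large)
    self : ∀ x → ρ ≤ ρ ^ suc x
    self x = ≤-trans (≤-reflexive (sym (^-identityʳ ρ))) (^-monoʳ-≤ ρ {1} {suc x} (s≤s z≤n))
    ρ^≤n : ρ ^ (4 + t) ≤ n
    ρ^≤n = begin
      ρ ^ (4 + t)                  ≡⟨ cong (_^ (4 + t)) (rate-cubic (suc p)) ⟩
      (80 * suc p ^ 3) ^ (4 + t)   ≤⟨ proj₂ (polynomial≤exponential 80 (4 + t)) p (≤-trans (m≤m+n p₀ (2 + t)) b≤p) ⟩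
      2 ^ p                        ≤⟨ 2^p≤n ⟩
      n                            ∎

-- Stability

∣p∣≤∣p∩q∣⇒p⊆q : ∀ {n} (p q : Subset n) → ∣ p ∣ ≤ ∣ p ∩ q ∣ → p ⊆ q
∣p∣≤∣p∩q∣⇒p⊆q p q le {x} x∈p with x ∈? q
... | yes x∈q = x∈q
... | no x∉q = contradiction le (<⇒≱ (p⊂q⇒∣p∣<∣q∣
  ((λ y∈ → proj₁ (x∈p∩q⁻ p q y∈)) , x , x∈p , λ x∈ → x∉q (proj₂ (x∈p∩q⁻ p q x∈)))))

bound-closed : ∀ n k t → bound n (suc k) t ≡ ((n ∸ t) !) ^ k
bound-closed n k t = begin-equality
  bound n (suc k) t
    ≡⟨ cong (λ x → (x / ((n ∸ t) !)) {{(n ∸ t) !≢0}})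
         (trans (cong (_^ suc k) (nPn≡n! (n ∸ t))) (*-comm ((n ∸ t) !) _)) ⟩
  (((n ∸ t) !) ^ k * (n ∸ t) ! / ((n ∸ t) !)) {{(n ∸ t) !≢0}}
    ≡⟨ m*n/n≡m (((n ∸ t) !) ^ k) ((n ∸ t) !) {{(n ∸ t) !≢0}} ⟩
  ((n ∸ t) !) ^ k ∎
  where open ≤-Reasoning

module Stability (k n : ℕ) .{{_ : NonZero k}} where

  open ≤-Reasoning
  open Matchings k n
  open Hitting k n

  degree≤supers : ∀ {G} → Unique G → All (Matching n) G → ∀ S → degree G S ≤ supers S
  degree≤supers {G} G! perf S = begin
    degree G S
      ≤⟨ ∑-mono G (λ {M} M∈G → 𝟙-mono (S ⊆? M) (perfect⊇? S M) λ S⊆M → All.lookup perf M∈G , λ {x} → S⊆M {x}) ⟩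
    ∑ G (λ M → 𝟙 (perfect⊇? S M))
      ≤⟨ ∑-mono-⊆ _≟ˢ_ G! (λ _ → ∈-subsets _) _ ⟩
    supers S ∎

  -- A core of a nonempty family has positive degree, so it is contained in a member and inherits
  -- disjointness from it.
  core-matching : ∀ {G r} S → All (Matching n) G → IsCore G r S → 1 ≤ length G → Matching ∣ S ∣ S
  core-matching {G} {r} S perf isCore G≢[] = case ∑-<⇒∃ G (λ _ → 0) (λ M → 𝟙 (S ⊆? M))
      (subst (_< degree G S) (sym (∑-zero G λ _ → refl)) (core-degree G r S isCore G≢[])) of
    λ { (M , M∈G , S⊆M) → ⊆-matching {M = M} (All.lookup perf M∈G) (𝟙-true (S ⊆? M) S⊆M) }

  core-bound : ∀ {G r} S → Unique G → All (Matching n) G → IsCore G r S → 1 ≤ length G →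
               length G ≤ ((n ∸ ∣ S ∣) !) ^ k * r ^ ∣ S ∣
  core-bound {G} {r} S G! perf isCore G≢[] = begin
    length G                            ≤⟨ core-size G r S isCore ⟩
    degree G S * r ^ ∣ S ∣              ≤⟨ *-monoˡ-≤ (r ^ ∣ S ∣) (degree≤supers G! perf S) ⟩
    supers S * r ^ ∣ S ∣                ≡⟨ cong (_* r ^ ∣ S ∣) (supers-matching (n ∸ ∣ S ∣) matS (m∸n+n≡m (∣matching∣≤n matS))) ⟩
    ((n ∸ ∣ S ∣) !) ^ k * r ^ ∣ S ∣     ∎
    where
    matS = core-matching S perf isCore G≢[]

  module _ {t m} (large : LargeEnough t n m) where

    open LargeEnough large

    private
      ρ = rate m

    small-core : ∀ {G u} S → u ≤ 2 + t → Unique G → All (Matching n) G → IsCore G ρ S → 1 ≤ length G →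
                 u < ∣ S ∣ → length G < ((n ∸ u) !) ^ k
    small-core {G} {u} S u≤ G! perf isCore G≢[] u<∣S∣ = ≤-<-trans (core-bound S G! perf isCore G≢[])
      (factorial-gap-^ {N = n ∸ u} {u = u} {s = ∣ S ∣} {d = n ∸ ∣ S ∣} k 2≤rate (first u u≤) (last u u≤)
        (trans (m+[n∸m]≡n s≤n) (sym (m∸n+n≡m (<⇒≤ (<-≤-trans u<∣S∣ s≤n)))))
        (∸-monoʳ-< u<∣S∣ s≤n))
      where
      s≤n = ∣matching∣≤n (core-matching S perf isCore G≢[])

    perfect-size : ∀ {G} → All (Matching n) G → ∀ {M} → M ∈ˡ G → ∣ M ∣ < 2 ^ m
    perfect-size perf M∈G = subst (_< 2 ^ m) (sym (proj₁ (All.lookup perf M∈G))) n<2^m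

    -- The common `t`-matching of a family at least as large as a star

    module _ (G : List (EdgeSet (suc k) n)) (G! : Unique G) (perf : All (Matching n) G)
      (intersecting : ∀ M M′ → M ∈ˡ G → M′ ∈ˡ G → t ≤ ∣ M ∩ M′ ∣)
      (big : ((n ∸ t) !) ^ k ≤ length G) where

      private
        G≢[] : 1 ≤ length G
        G≢[] = ≤-trans (m^n>0 ((n ∸ t) !) {{(n ∸ t) !≢0}} k) big

        C : EdgeSet (suc k) n
        C = proj₁ (core G ρ)

        isCore : IsCore G ρ C
        isCore = proj₂ (core G ρ)

        ∣C∣≤t : ∣ C ∣ ≤ t
        ∣C∣≤t = ≮⇒≥ λ t<∣C∣ → <⇒≱ (small-core C (m≤n+m t 2) G! perf isCore G≢[] t<∣C∣) big

        fits : ∀ {S : EdgeSet (suc k) n} → ∣ S ∣ ≤ 2 + t → 2 * ∣ S ∣ ≤ ρ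
        fits le = ≤-trans (*-monoʳ-≤ 2 le) cores-fit

        t≤∣C∣ : t ≤ ∣ C ∣
        t≤∣C∣ = case cores-meet m 1≤m G G C C (perfect-size perf) (perfect-size perf) isCore isCore
                  (fits {C} (≤-trans ∣C∣≤t (m≤n+m t 2))) (fits {C} (≤-trans ∣C∣≤t (m≤n+m t 2))) G≢[] G≢[] of
          λ { (M₁ , M₂ , M₁∈ , M₂∈ , _ , _ , meet) → begin
            t             ≤⟨ intersecting M₁ M₂ M₁∈ M₂∈ ⟩
            ∣ M₁ ∩ M₂ ∣   ≤⟨ p⊆q⇒∣p∣≤∣q∣ meet ⟩
            ∣ C ∩ C ∣     ≤⟨ p⊆q⇒∣p∣≤∣q∣ {p = C ∩ C} {q = C} (proj₁ ∘ x∈p∩q⁻ C C) ⟩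
            ∣ C ∣         ∎ }

        ∣C∣≡t : ∣ C ∣ ≡ t
        ∣C∣≡t = ≤-antisym ∣C∣≤t t≤∣C∣

        matC : Matching t C
        matC = subst (λ r → Matching r C) ∣C∣≡t (core-matching C perf isCore G≢[])

        misses? : ∀ M → Dec (¬ C ⊆ M)
        misses? M = ¬? (C ⊆? M)

        G′ : List (EdgeSet (suc k) n)
        G′ = filter misses? G

        ∈-G′⁻ : ∀ {M} → M ∈ˡ G′ → M ∈ˡ G × ¬ C ⊆ M
        ∈-G′⁻ = ∈-filter⁻ misses? {xs = G}

        perf′ : All (Matching n) G′
        perf′ = All.tabulate (All.lookup perf ∘ proj₁ ∘ ∈-G′⁻)

        C′ : EdgeSet (suc k) n
        C′ = proj₁ (core G′ ρ)

        isCore′ : IsCore G′ ρ C′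
        isCore′ = proj₂ (core G′ ρ)

        large-core′ : 1 ≤ length G′ → 2 + t < ∣ C′ ∣
        large-core′ G′≢[] = ≰⇒> λ ∣C′∣≤ → case cores-meet m 1≤m G G′ C C′ (perfect-size perf) (perfect-size perf′) isCore isCore′
            (fits {C} (≤-trans ∣C∣≤t (m≤n+m t 2))) (fits {C′} ∣C′∣≤) G≢[] G′≢[] of
          λ { (M₁ , M₂ , M₁∈ , M₂∈ , _ , C′⊆M₂ , meet) → proj₂ (∈-G′⁻ M₂∈) (λ {x} x∈C →
            -- Since `∣ C ∣ ≤ t ≤ ∣ C ∩ C′ ∣`, the set `C` lies in `C′` and hence in `M₂`, although
            -- members of `G′` do not contain `C`.
            C′⊆M₂ (∣p∣≤∣p∩q∣⇒p⊆q C C′ (begin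
              ∣ C ∣         ≤⟨ ∣C∣≤t ⟩
              t             ≤⟨ intersecting M₁ M₂ M₁∈ (proj₁ (∈-G′⁻ M₂∈)) ⟩
              ∣ M₁ ∩ M₂ ∣   ≤⟨ p⊆q⇒∣p∣≤∣q∣ meet ⟩
              ∣ C ∩ C′ ∣    ∎) x∈C)) }

        length-split : length G ≡ degree G C + length G′
        length-split = begin-equality
          length G
            ≡⟨ sym (∑-one G) ⟩
          ∑ G (λ _ → 1)
            ≡⟨ ∑-cong G (λ M → complement (C ⊆? M)) ⟩
          ∑ G (λ M → 𝟙 (C ⊆? M) + 𝟙 (misses? M))
            ≡⟨ ∑-+ G _ _ ⟩
          degree G C + ∑ G (λ M → 𝟙 (misses? M))
            ≡⟨ cong (degree G C +_) (sym (length-filter misses? G)) ⟩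
          degree G C + length G′ ∎
          where
          complement : ∀ {p} {P : Set p} (d : Dec P) → 1 ≡ 𝟙 d + 𝟙 (¬? d)
          complement (yes _) = refl
          complement (no _) = refl

        -- If `A ∩ M` stayed inside `C`, its at least `t` points would fill `C`, and `M` would
        -- contain `C`.
        degree≤hitters : ∀ {M} → M ∈ˡ G′ → degree G C ≤ hitters C M
        degree≤hitters {M} M∈G′ = ≤-trans
          (∑-mono G λ {A} A∈G → 𝟙-mono (C ⊆? A) (hitting? C M A) λ C⊆A →
            (All.lookup perf A∈G , λ {x} → C⊆A {x}) , outside-C A A∈G)
          (∑-mono-⊆ _≟ˢ_ G! (λ _ → ∈-subsets _) _)
          where
          outside-C : ∀ A → A ∈ˡ G → Nonempty ((A ∩ M) ─ C)
          outside-C A A∈G with nonempty? ((A ∩ M) ─ C)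
          ... | yes h = h
          ... | no empty = contradiction (λ {x} x∈C → proj₂ (x∈p∩q⁻ A M (C⊆A∩M x∈C))) (proj₂ (∈-G′⁻ M∈G′))
            where
            A∩M⊆C : A ∩ M ⊆ C
            A∩M⊆C {x} x∈ with x ∈? C
            ... | yes x∈C = x∈C
            ... | no x∉C = contradiction (x , x∈p∧x∉q⇒x∈p─q x∈ x∉C) empty
            C⊆A∩M : C ⊆ A ∩ M
            C⊆A∩M = ∣p∣≤∣p∩q∣⇒p⊆q C (A ∩ M) (begin
              ∣ C ∣             ≤⟨ ∣C∣≤t ⟩
              t                 ≤⟨ intersecting A M A∈G (proj₁ (∈-G′⁻ M∈G′)) ⟩
              ∣ A ∩ M ∣         ≤⟨ p⊆q⇒∣p∣≤∣q∣ (λ x∈ → x∈p∩q⁺ (A∩M⊆C x∈ , x∈)) ⟩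
              ∣ C ∩ (A ∩ M) ∣   ∎)

        G′≡[] : ∀ {M} → ¬ M ∈ˡ G′
        G′≡[] {M} M∈G′ = <⇒≱ (begin-strict
          length G
            ≡⟨ length-split ⟩
          degree G C + length G′
            <⟨ +-monoʳ-< (degree G C) (small-core C′ ≤-refl (Unique.filter⁺ misses? G!) perf′ isCore′ G′≢[] (large-core′ G′≢[])) ⟩
          degree G C + (d !) ^ k
            ≤⟨ +-monoˡ-≤ ((d !) ^ k) (degree≤hitters M∈G′) ⟩
          hitters C M + (d !) ^ k
            ≤⟨ hitters-bound matC (All.lookup perf′ M∈G′) (trans (sym (+-assoc 2 d t)) (trans (cong (_+ t)
                      (+-comm 2 d)) (trans (+-assoc d 2 t) (m∸n+n≡m room)))) ⟩
          (2 + d) * ((1 + d) !) ^ k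
            -- For two parts, `k = 1`, this step is an equality. The strictness of the chain comes
            -- from `G′` being smaller than the overcount `(d !) ^ k`.
            ≤⟨ *-monoˡ-≤ (((1 + d) !) ^ k) (≤-trans (≤-reflexive (sym (^-identityʳ (2 + d)))) (^-monoʳ-≤ (2 + d) (>-nonZero⁻¹ k))) ⟩
          (2 + d) ^ k * ((1 + d) !) ^ k
            ≡⟨ sym (^-distribʳ-* k (2 + d) ((1 + d) !)) ⟩
          ((2 + d) !) ^ k
            ≡⟨ cong (λ x → (x !) ^ k) (trans (sym (+-∸-assoc 2 room)) refl) ⟩
          ((n ∸ t) !) ^ k ∎) big
          where
          d = n ∸ (2 + t)
          G′≢[] : 1 ≤ length G′
          G′≢[] = ≤-trans (∑-term (λ _ → 1) M∈G′) (≤-reflexive (∑-one G′))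

      common-matching : ∃[ C ] Matching t C × (∀ {M} → M ∈ˡ G → C ⊆ M)
      common-matching = C , matC , λ {M} M∈G → contained M M∈G
        where
        contained : ∀ M → M ∈ˡ G → C ⊆ M
        contained M M∈G with C ⊆? M
        ... | yes C⊆M = C⊆M
        ... | no C⊈M = contradiction (∈-filter⁺ misses? M∈G C⊈M) G′≡[]

  -- Stars and the equality case

  star : EdgeSet (suc k) n → List (EdgeSet (suc k) n)
  star C = filter (perfect⊇? C) (subsets (n ^ suc k))

  length-star : ∀ {t C} → Matching t C → length (star C) ≡ ((n ∸ t) !) ^ k
  length-star {t} {C} matC = trans (length-filter (perfect⊇? C) (subsets (n ^ suc k)))
    (supers-matching (n ∸ t) matC (m∸n+n≡m (∣matching∣≤n matC)))

  ∈-star⁺ : ∀ {C M} → Matching n M × C ⊆ M → M ∈ˡ star C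
  ∈-star⁺ {C} {M} h = ∈-filter⁺ (perfect⊇? C) (∈-subsets M) h

  ∈-star⁻ : ∀ {C M} → M ∈ˡ star C → Matching n M × C ⊆ M
  ∈-star⁻ {C} M∈ = proj₂ (∈-filter⁻ (perfect⊇? C) {xs = subsets (n ^ suc k)} M∈)

  star-unique : ∀ C → Unique (star C)
  star-unique C = Unique.filter⁺ (perfect⊇? C) (subsets-unique (n ^ suc k))

length-mono-⊆ : ∀ {a} {A : Set a} → DecidableEquality A → ∀ {xs ys : List A} → Unique xs →
                (∀ {x} → x ∈ˡ xs → x ∈ˡ ys) → length xs ≤ length ys
length-mono-⊆ _≟ᴬ_ {xs} {ys} xs! xs⊆ys = subst₂ _≤_ (∑-one xs) (∑-one ys) (∑-mono-⊆ _≟ᴬ_ xs! xs⊆ys (λ _ → 1))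

star⇒bound : ∀ {n k t} .{{_ : NonZero k}} (ℱ : Family (suc k) n) → IsStar t ℱ → card ℱ ≡ bound n (suc k) t
star⇒bound {n} {k} {t} ℱ (C , matC , members⇔) = trans (≤-antisym
    (length-mono-⊆ _≟ˢ_ (unique ℱ) λ M∈ → ∈-star⁺ (Equivalence.to (members⇔ _) M∈))
    (length-mono-⊆ _≟ˢ_ (star-unique C) λ {M} M∈ → Equivalence.from (members⇔ M) (∈-star⁻ M∈)))
  (trans (length-star matC) (sym (bound-closed n k t)))
  where open Stability k n

bound≤card⇒star : ∀ {n k t m} .{{_ : NonZero k}} → LargeEnough t n m → (ℱ : Family (suc k) n) → Intersecting t ℱ →
                  bound n (suc k) t ≤ card ℱ → IsStar t ℱ
bound≤card⇒star {n} {k} {t} large ℱ intersecting big =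
  let C , matC , common = common-matching large (members ℱ) (unique ℱ) (matching ℱ) intersecting big′
  in C , matC , λ M → mk⇔ (λ M∈ → All.lookup (matching ℱ) M∈ , λ {x} → common M∈ {x}) (complete C matC common M)
  where
  open Stability k n
  big′ : ((n ∸ t) !) ^ k ≤ card ℱ
  big′ = ≤-trans (≤-reflexive (sym (bound-closed n k t))) big
  complete : ∀ C → IsMatching (suc k) n t C → (∀ {M} → M ∈ˡ members ℱ → C ⊆ M) →
             ∀ M → IsMatching (suc k) n n M × C ⊆ M → M ∈ˡ members ℱ
  complete C matC common M h with any? (M ≟ˢ_) (members ℱ)
  ... | yes M∈ = M∈
  -- Adding a missing `M` would give a list without repetition inside the star, so `card ℱ` would be
  -- less than the size of the star, which is the bound.
  ... | no M∉ = contradiction big′ (<⇒≱ (≤-trans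
    (length-mono-⊆ _≟ˢ_ {M ∷ members ℱ} {star C} (All.tabulate (λ x∈ M≡x → M∉ (lose x∈ M≡x)) ∷ unique ℱ)
      λ { (here refl) → ∈-star⁺ h ; (there x∈) → ∈-star⁺ (All.lookup (matching ℱ) x∈ , λ {x} → common x∈ {x}) })
    (≤-reflexive (length-star matC))))

theorem3p4 : ∀ (t : ℕ) → 1 ≤ t →
    ∃[ n₀ ] t ≤ n₀ ×
    (∀ (n k : ℕ) → n₀ ≤ n → 2 ≤ k →
    ∀ (ℱ : Family k n) → Intersecting t ℱ →
    card ℱ ≤ bound n k t ×
    (card ℱ ≡ bound n k t ⇔ IsStar t ℱ))
theorem3p4 t _ = let n₀ , t≤n₀ , large = large-enough t in
  n₀ , t≤n₀ , λ n k n₀≤n 2≤k ℱ intersecting → conclude 2≤k (proj₂ (large n n₀≤n)) ℱ intersecting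
  where
  conclude : ∀ {n k m} → 2 ≤ k → LargeEnough t n m → (ℱ : Family k n) → Intersecting t ℱ →
             card ℱ ≤ bound n k t × (card ℱ ≡ bound n k t ⇔ IsStar t ℱ)
  conclude {k = suc zero} (s≤s ()) _ _ _
  conclude {n} {suc (suc k)} _ large ℱ intersecting = upper , mk⇔ (is-star ∘ ≤-reflexive ∘ sym) (star⇒bound ℱ)
    where
    is-star : bound n (suc (suc k)) t ≤ card ℱ → IsStar t ℱ
    is-star = bound≤card⇒star large ℱ intersecting
    upper : card ℱ ≤ bound n (suc (suc k)) t
    -- A family reaching or exceeding the bound is a star, and a star has exactly the size of the
    -- bound.
    upper with ≤-total (card ℱ) (bound n (suc (suc k)) t)
    ... | inj₁ le = le
    ... | inj₂ ge = ≤-reflexive (star⇒bound ℱ (is-star ge))
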